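{- Let $G$ be a $d$-degenerate graph with $n$ vertices. Consider the procedure $\textsc{DegenerateCliques}(G,d)$: compute a $d$-degenerate vertex ordering $(v_1,\dots,v_n)$ of $G$ together with the sets $N^+(v_i)$ for $1\le i\le n$; then for $i=1,\dots,n$, run $\textsc{AllCliques}(G[\{v_i\}\cup N^+(v_i)])$. Then $\textsc{DegenerateCliques}(G,d)$ outputs all the cliques in $G$, in time $O(d\,2^d n)$.
   Context: Graphs are simple, finite and undirected. A clique is a set of pairwise adjacent vertices (the empty set and single vertices count). A graph is $d$-degenerate if every non-empty subgraph has a vertex of degree at most $d$. A linear ordering $(v_1,\dots,v_n)$ of $V(G)$ is $d$-degenerate if $|N^+(v_i)|\le d$ for each $i$, where $N^+(v_i)=\{v_j : j>i,\ v_iv_j\in E(G)\}$. The procedure $\textsc{AllCliques}(F)$ on a graph $F$ is: output $\emptyset$; set $i:=1$, $V_1:=V(F)$; repeat until $i=0$: if $V_i=\emptyset$ set $i:=i-1$; otherwise choose $x_i\in V_i$, output $\{x_1,\dots,x_i\}$, set $V_{i+1}:=V_i\cap N_F(x_i)$, $V_i:=V_i\setminus\{x_i\}$, $i:=i+1$.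
   Formalization: The graph is assumed to have n ≥ 1 vertices (for n = 0 the procedure outputs nothing, although the empty set is a clique), and the time bound O(d 2^d n) is claimed only for d ≥ 1 (for d = 0 it would be zero); correctness is proved for every d. -}

module Defs where

open import Data.Bool using (Bool; true; false; if_then_else_; not)
open import Data.Fin using (Fin; toℕ)
open import Data.Fin.Properties using () renaming (_≟_ to _≟ᶠ_)
open import Data.Fin.Subset using (Subset; _∈_; Nonempty; ∣_∣; ⋃; ⁅_⁆)
open import Data.List using (List; []; _∷_; _++_; length; map; filter; drop; lookup; removeAt; allFin)
import Data.List.Membership.Propositional as List∈
open import Data.List.Relation.Unary.Unique.Propositional using (Unique)
open import Data.List.Relation.Binary.Permutation.Propositional using (_↭_)
open import Data.Nat using (ℕ; suc; _+_; _*_; _^_; _≤_; pred; _≡ᵇ_; _≤ᵇ_)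
open import Data.Product using (_×_; _,_; ∃-syntax; proj₁; proj₂)
open import Data.Sum using (_⊎_; inj₁; inj₂)
open import Data.Unit using (⊤; tt)
open import Data.Vec using (tabulate)
open import Function.Bundles using (_⇔_)
open import Relation.Binary.Definitions using (Decidable; Symmetric; Irreflexive)
open import Relation.Binary.PropositionalEquality using (_≡_; _≢_; refl)
open import Relation.Nullary using (does)

record Graph (n : ℕ) : Set₁ where
  field
    E        : Fin n → Fin n → Set
    E?       : Decidable E
    E-sym    : Symmetric E
    E-irrefl : Irreflexive _≡_ E

-- Not necessarily induced.
record Subgraph {n : ℕ} (G : Graph n) : Set₁ where
  field
    vertices : Subset n
    Eᴴ       : Fin n → Fin n → Set
    Eᴴ?      : Decidable Eᴴ
    Eᴴ-sym   : Symmetric Eᴴ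
    Eᴴ⊆E     : ∀ {u v} → Eᴴ u v → Graph.E G u v
    Eᴴ-ends  : ∀ {u v} → Eᴴ u v → u ∈ vertices

  degree : Fin n → ℕ
  degree v = ∣ tabulate (λ u → does (Eᴴ? v u)) ∣

Degenerate : {n : ℕ} → Graph n → ℕ → Set₁
Degenerate G d = (H : Subgraph G) → Nonempty (vertices H) →
                 ∃[ v ] v ∈ vertices H × degree H v ≤ d
  where open Subgraph

IsClique : {n : ℕ} → Graph n → Subset n → Set
IsClique G S = ∀ {u v} → u ∈ S → v ∈ S → u ≢ v → Graph.E G u v

N⁺ : {n : ℕ} → Graph n → (vs : List (Fin n)) → Fin (length vs) → List (Fin n)
N⁺ G vs i = filter (Graph.E? G (lookup vs i)) (drop (suc (toℕ i)) vs)

-- For vs a permutation of the vertices N⁺ G vs i has no repetitions, so its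
-- length is its cardinality.
IsDegenerateOrdering : {n : ℕ} → Graph n → ℕ → List (Fin n) → Set
IsDegenerateOrdering {n} G d vs =
  vs ↭ allFin n × (∀ i → length (N⁺ G vs i) ≤ d)

-- Machine model: a unit-cost random access machine whose memory consists of
-- arrays indexed by the vertices.  Cells hold a number, a bit or (a pointer
-- to) an immutable linked list.

data Array : Set where
  adj  : Array  -- input: adjacency lists of G
  deg  : Array  -- number of neighbours not yet placed in the ordering
  done : Array  -- already placed in the ordering?
  fwd  : Array  -- the sets N⁺
  nbr  : Array  -- adjacency lists of the current subgraph F
  mark : Array  -- scratch

Cell : ℕ → Array → Set
Cell n adj  = List (Fin n)
Cell n deg  = ℕ
Cell n done = Bool
Cell n fwd  = List (Fin n)
Cell n nbr  = List (Fin n)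
Cell n mark = Bool

data Op (n : ℕ) : Set → Set where
  read   : (a : Array) → Fin n → Op n (Cell n a)
  write  : (a : Array) → Fin n → Cell n a → Op n ⊤
  output : List (Fin n) → Op n ⊤
  -- choose x xs: pick an arbitrary entry of the list x ∷ xs and return it
  -- with the rest of the list.
  choose : Fin n → List (Fin n) → Op n (Fin n × List (Fin n))

infixl 1 _>>=_ _>>_

-- loop body s repeats body, starting from s, until it returns inj₂.  It is the
-- only means of iteration used in the programs below: apart from it they
-- perform a bounded number of constructor, projection and arithmetic steps
-- between operations.
data Prog (n : ℕ) : Set → Set₁ where
  return : {A : Set} → A → Prog n A
  op     : {A : Set} → Op n A → Prog n A
  _>>=_  : {A B : Set} → Prog n A → (A → Prog n B) → Prog n B
  loop   : {S A : Set} → (S → Prog n (S ⊎ A)) → S → Prog n A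

_>>_ : {n : ℕ} {A B : Set} → Prog n A → Prog n B → Prog n B
p >> q = p >>= λ _ → q

record State (n : ℕ) : Set where
  constructor state
  field
    memory  : (a : Array) → Fin n → Cell n a
    outputs : List (List (Fin n))
    time    : ℕ

open State public

-- Resolution of the nondeterministic choices.  The state includes the elapsed
-- time, so every sequence of choices in a run arises from some Chooser.
Chooser : ℕ → Set
Chooser n = State n → (x : Fin n) (xs : List (Fin n)) → Fin (length (x ∷ xs))

set : {n : ℕ} → ((a : Array) → Fin n → Cell n a) →
      (a : Array) → Fin n → Cell n a → (b : Array) → Fin n → Cell n b
set m adj  i c adj  j = if does (i ≟ᶠ j) then c else m adj j
set m deg  i c deg  j = if does (i ≟ᶠ j) then c else m deg j
set m done i c done j = if does (i ≟ᶠ j) then c else m done j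
set m fwd  i c fwd  j = if does (i ≟ᶠ j) then c else m fwd j
set m nbr  i c nbr  j = if does (i ≟ᶠ j) then c else m nbr j
set m mark i c mark j = if does (i ≟ᶠ j) then c else m mark j
set m _    _ _ b    j = m b j

elapse : {n : ℕ} → ℕ → State n → State n
elapse k (state m o t) = state m o (k + t)

-- Memory accesses cost 1; writing out a set, and walking along a list to
-- unlink an entry, are charged for the length of the list.
exec : {n : ℕ} {A : Set} → Chooser n → Op n A → State n → A × State n
exec χ (read a i)    σ = memory σ a i , elapse 1 σ
exec χ (write a i c) (state m o t) = tt , state (set m a i c) o (1 + t)
exec χ (output xs)   (state m o t) = tt , state m (o ++ xs ∷ []) (1 + length xs + t)
exec χ (choose x xs) σ =
  (lookup (x ∷ xs) i , removeAt (x ∷ xs) i) , elapse (length (x ∷ xs)) σ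
  where i = χ σ x xs

infix 0 _⊢⟨_,_⟩⇓⟨_,_⟩

-- Each round of a loop costs 1 in addition to the cost of its body.
data _⊢⟨_,_⟩⇓⟨_,_⟩ {n : ℕ} (χ : Chooser n) :
     {A : Set} → Prog n A → State n → A → State n → Set₁ where
  ⇓return : ∀ {A} {a : A} {σ} → χ ⊢⟨ return a , σ ⟩⇓⟨ a , σ ⟩
  ⇓op     : ∀ {A} {o : Op n A} {σ} →
            χ ⊢⟨ op o , σ ⟩⇓⟨ proj₁ (exec χ o σ) , proj₂ (exec χ o σ) ⟩
  ⇓bind   : ∀ {A B} {p : Prog n A} {k : A → Prog n B} {a b σ σ′ σ″} →
            χ ⊢⟨ p , σ ⟩⇓⟨ a , σ′ ⟩ →
            χ ⊢⟨ k a , σ′ ⟩⇓⟨ b , σ″ ⟩ →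
            χ ⊢⟨ p >>= k , σ ⟩⇓⟨ b , σ″ ⟩
  ⇓stop   : ∀ {S A} {body : S → Prog n (S ⊎ A)} {s a σ σ′} →
            χ ⊢⟨ body s , σ ⟩⇓⟨ inj₂ a , σ′ ⟩ →
            χ ⊢⟨ loop body s , σ ⟩⇓⟨ a , elapse 1 σ′ ⟩
  ⇓again  : ∀ {S A} {body : S → Prog n (S ⊎ A)} {s s′ a σ σ′ σ″} →
            χ ⊢⟨ body s , σ ⟩⇓⟨ inj₁ s′ , σ′ ⟩ →
            χ ⊢⟨ loop body s′ , elapse 1 σ′ ⟩⇓⟨ a , σ″ ⟩ →
            χ ⊢⟨ loop body s , σ ⟩⇓⟨ a , σ″ ⟩

-- Once χ is fixed a program has at most one run, so exhibiting a terminating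
-- run for every χ describes all of its executions.
⇓-deterministic : ∀ {n} {χ : Chooser n} {A} {p : Prog n A} {σ a b σ′ σ″} →
                  χ ⊢⟨ p , σ ⟩⇓⟨ a , σ′ ⟩ → χ ⊢⟨ p , σ ⟩⇓⟨ b , σ″ ⟩ →
                  (a , σ′) ≡ (b , σ″)
⇓-deterministic ⇓return ⇓return = refl
⇓-deterministic ⇓op ⇓op = refl
⇓-deterministic (⇓bind p q) (⇓bind p′ q′) with ⇓-deterministic p p′
... | refl = ⇓-deterministic q q′
⇓-deterministic (⇓stop p) (⇓stop p′) with ⇓-deterministic p p′
... | refl = refl
⇓-deterministic (⇓stop p) (⇓again p′ q′) with ⇓-deterministic p p′
... | ()
⇓-deterministic (⇓again p q) (⇓stop p′) with ⇓-deterministic p p′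
... | ()
⇓-deterministic (⇓again p q) (⇓again p′ q′) with ⇓-deterministic p p′
... | refl = ⇓-deterministic q q′

module _ {n : ℕ} where

  foldStep : {B : Set} → (B → Fin n → Prog n B) →
             B × List (Fin n) → Prog n ((B × List (Fin n)) ⊎ B)
  foldStep f (b , [])     = return (inj₂ b)
  foldStep f (b , x ∷ xs) = f b x >>= λ b′ → return (inj₁ (b′ , xs))

  fold : {B : Set} → (B → Fin n → Prog n B) → B → List (Fin n) → Prog n B
  fold f b xs = loop (foldStep f) (b , xs)

  forEach : List (Fin n) → (Fin n → Prog n ⊤) → Prog n ⊤
  forEach xs f = fold (λ _ → f) tt xs

  count : List (Fin n) → Prog n ℕ
  count = fold (λ k _ → return (suc k)) 0

  reversed : List (Fin n) → Prog n (List (Fin n))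
  reversed = fold (λ acc x → return (x ∷ acc)) []

  select : (Fin n → Prog n Bool) → List (Fin n) → Prog n (List (Fin n))
  select test = fold (λ acc x → do
    b ← test x
    return (if b then x ∷ acc else acc)) []

  -- N_F is read from the array nbr.
  _∩N_ : List (Fin n) → Fin n → Prog n (List (Fin n))
  V ∩N x = do
    ns ← op (read nbr x)
    forEach ns (λ u → op (write mark u true))
    W ← select (λ u → op (read mark u)) V
    forEach ns (λ u → op (write mark u false))
    return W

  -- (x_{i-1} ∷ … ∷ x₁ ∷ [] , V_i ∷ … ∷ V₁ ∷ []); thus i is the length of the
  -- second component.
  Stack : Set
  Stack = List (Fin n) × List (List (Fin n))

  cliqueStep : Stack → Prog n (Stack ⊎ ⊤)
  cliqueStep (xs , [])           = return (inj₂ tt)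
  cliqueStep (xs , [] ∷ Vs)      = return (inj₁ (drop 1 xs , Vs))
  cliqueStep (xs , (y ∷ V) ∷ Vs) = do
    (x , V∖x) ← op (choose y V)
    op (output (x ∷ xs))
    W ← (y ∷ V) ∩N x
    return (inj₁ (x ∷ xs , W ∷ V∖x ∷ Vs))

  allCliques : List (Fin n) → Prog n ⊤
  allCliques V₁ = do
    op (output [])
    loop cliqueStep ([] , V₁ ∷ [])

  link : Fin n → Fin n → Prog n ⊤
  link u w = do
    us ← op (read nbr u)
    op (write nbr u (w ∷ us))
    ws ← op (read nbr w)
    op (write nbr w (u ∷ ws))

  -- Store in nbr the adjacency lists of the subgraph induced by F.  Every edge
  -- uw occurs in exactly one of the lists fwd u and fwd w.
  induce : List (Fin n) → Prog n ⊤
  induce F = do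
    forEach F (λ u → do
      op (write mark u true)
      op (write nbr u []))
    forEach F (λ u → do
      ws ← op (read fwd u)
      forEach ws (λ w → do
        b ← op (read mark w)
        if b then link u w else return tt))
    forEach F (λ u → op (write mark u false))

-- A routine for "compute a d-degenerate ordering together with the sets N⁺":
-- the ordering is returned, N⁺(v) is left in fwd.
OrderingRoutine : Set₁
OrderingRoutine = {n : ℕ} → (d : ℕ) → Prog n (List (Fin n))

degenerateCliques : OrderingRoutine → {n : ℕ} → (d : ℕ) → Prog n ⊤
degenerateCliques ordering d = do
  vs ← ordering d
  forEach vs (λ v → op (write mark v false))
  forEach vs (λ v → do
    ws ← op (read fwd v)
    induce (v ∷ ws)
    allCliques (v ∷ ws))

module _ {n : ℕ} (d : ℕ) where

  initialise : Fin n → Prog n Bool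
  initialise v = do
    op (write done v false)
    ns ← op (read adj v)
    k  ← count ns
    op (write deg v k)
    return (k ≤ᵇ d)

  remaining : Fin n → Prog n Bool
  remaining u = do
    b ← op (read done u)
    return (not b)

  lower : List (Fin n) → Fin n → Prog n (List (Fin n))
  lower work u = do
    k ← op (read deg u)
    op (write deg u (pred k))
    return (if k ≡ᵇ suc d then u ∷ work else work)

  -- State: the worklist, and the ordering so far in reverse.
  remove : List (Fin n) × List (Fin n) →
           Prog n ((List (Fin n) × List (Fin n)) ⊎ List (Fin n))
  remove ([]       , rev) = return (inj₂ rev)
  remove (v ∷ work , rev) = do
    op (write done v true)
    ns ← op (read adj v)
    ws ← select remaining ns
    op (write fwd v ws)
    work′ ← fold lower work ws
    return (inj₁ (work′ , v ∷ rev))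

-- Repeatedly remove a vertex with at most d remaining neighbours.  The
-- worklist holds the remaining vertices with that property; a vertex enters it
-- initially or when its remaining degree drops from d + 1 to d.
peel : OrderingRoutine
peel {n} d = do
  work ← select (initialise d) (allFin n)
  rev  ← loop (remove d) (work , [])
  reversed rev

-- G is given by adjacency lists; the other arrays may contain anything.
record Input {n : ℕ} (G : Graph n) (σ : State n) : Set where
  field
    adj-unique : ∀ v → Unique (memory σ adj v)
    adj-edges  : ∀ u v → (v List∈.∈ memory σ adj u) ⇔ Graph.E G u v
    no-outputs : outputs σ ≡ []
    at-start   : time σ ≡ 0

-- For d = 0 the expression d 2^d n vanishes, so the time bound is only meant
-- for d ≥ 1.
TimeBound : (c d n t : ℕ) → Set
TimeBound c d n t = 1 ≤ d → t ≤ c * (d * 2 ^ d * n)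

ComputesOrdering : OrderingRoutine → (c : ℕ) → Set₁
ComputesOrdering ordering c =
  ∀ n d (G : Graph n) (χ : Chooser n) (σ : State n) →
  1 ≤ n → Degenerate G d → Input G σ →
  ∃[ vs ] ∃[ σ′ ]
    (χ ⊢⟨ ordering d , σ ⟩⇓⟨ vs , σ′ ⟩)
    × IsDegenerateOrdering G d vs
    × (∀ i → memory σ′ fwd (lookup vs i) ↭ N⁺ G vs i)
    × outputs σ′ ≡ []
    × TimeBound c d n (time σ′)

-- The sets S that have been output; {x₁,…,x_i} is output as a list.
Outputs : {n : ℕ} → State n → Subset n → Set
Outputs σ S = S List∈.∈ map (λ xs → ⋃ (map ⁅_⁆ xs)) (outputs σ)

{-# OPTIONS --safe #-}
-- Removing vertices of small remaining degree leaves the set N⁺(v) as the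
-- remaining neighbours of v at its removal.  Every edge is counted once in
-- some N⁺(v), so the degrees sum to at most 2dn and the removal takes time
-- O(dn).
--
-- A non-empty clique lies in {v} ∪ N⁺(v) for v its first vertex in the
-- ordering, so it is found there.  AllCliques on a stack with top V branches
-- on the chosen x: the cliques through x are searched in V ∩ N(x), the others
-- in V ∖ x, and both lists are shorter than V because x is not its own
-- neighbour.  Hence d + 1 vertices need at most 2^(d + 2) rounds of cost O(d).

module Submission where

open import Defs
open import Data.Bool using (Bool; true; false; if_then_else_; not; T)
open import Data.Bool.Properties using () renaming (_≟_ to _≟ᵇ_)
open import Data.Fin using (Fin; zero; suc)
open import Data.Fin.Properties using () renaming (_≟_ to _≟ᶠ_)
open import Data.Fin.Subset using (Subset; ∣_∣; _-_; ⋃; ⁅_⁆) renaming (_∈_ to _∈ˢ_)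
open import Data.Fin.Subset.Properties using (x∈p⇒∣p-x∣<∣p∣; x∈p∧x≢y⇒x∈p-y; ∉⊥; x∈p∪q⁺; x∈p∪q⁻; x∈⁅x⁆; x∈⁅y⁆⇒x≡y; ⊆-antisym) renaming (_∈?_ to _∈ˢ?_)
open import Data.List using (List; []; _∷_; _++_; length; map; filter; lookup; removeAt; _ʳ++_; allFin; drop)
open import Data.List.Membership.DecPropositional using () renaming (_∈?_ to ∈-dec)
open import Data.List.Membership.Propositional using (_∈_; _∉_; find; lose)
open import Data.List.Membership.Propositional.Properties using (∈-∃++; ∈-filter⁺; ∈-filter⁻; ∈-++⁺ˡ; ∈-++⁺ʳ; ∈-++⁻; ∈-allFin; ∈-map⁺; ∈-map⁻)
open import Data.List.Membership.Propositional.Properties.WithK using (unique∧set⇒bag)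
open import Data.List.Properties using (length-filter; filter-reject; filter-accept; length-tabulate; map-cong; filter-≐)
open import Data.List.Relation.Binary.BagAndSetEquality using (∼bag⇒↭)
open import Data.List.Relation.Binary.Permutation.Propositional using (_↭_; ↭-refl; ↭-sym; ↭-trans; ↭-reflexive; ↭⇒↭ₛ; prep; swap)
open import Data.List.Relation.Binary.Permutation.Propositional.Properties using (shift; ++-identityʳ; ∈-resp-↭; filter-↭; ↭-length; map⁺; ++⁺ˡ; ++↭ʳ++)
import Data.List.Relation.Binary.Permutation.Setoid.Properties as Permₛ
import Data.List.Relation.Unary.All as All
import Data.List.Relation.Unary.AllPairs as AllPairs
open import Data.List.Relation.Unary.Any using (here; there; any?)
open import Data.List.Relation.Unary.Unique.Propositional using (Unique; []; tail)
open import Data.List.Relation.Unary.Unique.Propositional.Properties using (Unique[x∷xs]⇒x∉xs; filter⁺; allFin⁺)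
open import Data.Nat using (ℕ; zero; suc; _+_; _*_; _≤_; z≤n; s≤s; _^_; _≡ᵇ_; _≤ᵇ_)
open import Data.Nat.ListAction using (sum)
open import Data.Nat.ListAction.Properties using (sum-↭)
open import Data.Nat.Properties
open import Data.Nat.Tactic.RingSolver using (solve-∀)
open import Data.Product using (_×_; _,_; ∃-syntax; proj₁; proj₂)
open import Data.Sum as Sum using (_⊎_; inj₁; inj₂; [_,_]′)
open import Data.Unit using (⊤; tt)
open import Data.Vec using (tabulate)
open import Data.Vec.Properties using (lookup∘tabulate; lookup⇒[]=; []=⇒lookup)
open import Function using (_∘_; id)
open import Function.Bundles using (_⇔_; mk⇔; Equivalence)
open import Relation.Binary.PropositionalEquality
open import Relation.Nullary using (yes; no; does; contradiction; ¬_; Dec; _×-dec_)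

-- The bound depends on never reading full neighbourhoods once the ordering is known. A member of
-- `F = {v} ∪ N⁺(v)` may have many neighbours in the graph, so the subgraph induced by `F` is built
-- from the lists in `fwd` alone. There a vertex is linked at most `d` times from its own list and
-- at most once from the list of each member of `F`, so its list in `nbr` has length at most
-- `d + |F| ≤ 2d + 1`. The O(d²) cost of this construction is absorbed by `1 + d ≤ 2 ^ d`. During
-- the search the prefix and the current list together have at most `d + 1` entries, so choosing,
-- writing out and intersecting each cost O(d). Two features of the machine shape the invariants.
-- Accumulators reverse lists and choices are arbitrary, so most lists are known only up to
-- permutation. Apart from `adj`, the arrays start with arbitrary contents, so a cell is trusted
-- only after it has been written.

private variable
  n : ℕ
  X B S : Set

-- Lists, permutations and sums

unique-resp-↭ : {xs ys : List X} → xs ↭ ys → Unique xs → Unique ys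
unique-resp-↭ p = Permₛ.Unique-resp-↭ (setoid _) (↭⇒↭ₛ p)

unique-∷ : {x : X} {xs : List X} → x ∉ xs → Unique xs → Unique (x ∷ xs)
unique-∷ x∉xs u = All.tabulate (λ { y∈xs refl → x∉xs y∈xs }) AllPairs.∷ u

unique∧set⇒↭ : {xs ys : List X} → Unique xs → Unique ys →
               (∀ {x} → x ∈ xs → x ∈ ys) → (∀ {x} → x ∈ ys → x ∈ xs) → xs ↭ ys
unique∧set⇒↭ u v f g = ∼bag⇒↭ (unique∧set⇒bag u v (mk⇔ f g))

∈⇒↭∷ : {x : X} {xs : List X} → x ∈ xs → ∃[ ys ] xs ↭ x ∷ ys
∈⇒↭∷ x∈xs with ys , zs , refl ← ∈-∃++ x∈xs = ys ++ zs , shift _ ys zs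

removeAt-↭ : (xs : List X) (i : Fin (length xs)) → xs ↭ lookup xs i ∷ removeAt xs i
removeAt-↭ (x ∷ xs) zero    = ↭-refl
removeAt-↭ (x ∷ xs) (suc i) = ↭-trans (prep x (removeAt-↭ xs i)) (swap x _ ↭-refl)

sum-map-const : (k : ℕ) (xs : List X) → sum (map (λ _ → k) xs) ≡ length xs * k
sum-map-const k []       = refl
sum-map-const k (x ∷ xs) = cong (k +_) (sum-map-const k xs)

m+[n+o]≡n+[m+o] : ∀ m n o → m + (n + o) ≡ n + (m + o)
m+[n+o]≡n+[m+o] = solve-∀

-- Total correctness with a cost bound

Memory : ℕ → Set
Memory n = (a : Array) → Fin n → Cell n a

Outs : ℕ → Set
Outs n = List (List (Fin n))

-- `Q` sees the memory and the outputs but not the clock, so a postcondition survives `elapse`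
-- definitionally. Time enters only through the bound `c` on its increase.
record Runs (χ : Chooser n) (p : Prog n X) (σ : State n) (c : ℕ)
            (Q : X → Memory n → Outs n → Set) : Set₁ where
  constructor runs
  field
    {value} : X
    {final} : State n
    run     : χ ⊢⟨ p , σ ⟩⇓⟨ value , final ⟩
    cost    : time final ≤ c + time σ
    post    : Q value (memory final) (outputs final)

module _ {χ : Chooser n} where

  private variable
    σ : State n
    p : Prog n X
    c c′ : ℕ
    P Q : X → Memory n → Outs n → Set

  weaken : c ≤ c′ → (∀ {x m o} → P x m o → Q x m o) → Runs χ p σ c P → Runs χ p σ c′ Q
  weaken c≤c′ f (runs r t q) = runs r (≤-trans t (+-monoˡ-≤ _ c≤c′)) (f q)

  within : c ≤ c′ → Runs χ p σ c Q → Runs χ p σ c′ Q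
  within c≤c′ = weaken c≤c′ λ q → q

  runs-return : {x : X} → Q x (memory σ) (outputs σ) → Runs χ (return x) σ 0 Q
  runs-return q = runs ⇓return ≤-refl q

  -- Of the state between the two parts only `P` is remembered, so the continuation has to run from
  -- every state satisfying it.
  runs-bind : {k : X → Prog n B} → Runs χ p σ c P →
              (∀ x {σ′} → P x (memory σ′) (outputs σ′) → Runs χ (k x) σ′ c′ Q) →
              Runs χ (p >>= k) σ (c + c′) Q
  runs-bind {σ = σ} {c = c} {c′ = c′} (runs r t p) f with f _ p
  ... | runs r′ t′ q = runs (⇓bind r r′) (begin
          _                    ≤⟨ t′ ⟩
          c′ + _               ≤⟨ +-monoʳ-≤ c′ t ⟩
          c′ + (c + time σ)    ≡⟨ rearrange c′ c (time σ) ⟩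
          c + c′ + time σ      ∎) q
    where
      open ≤-Reasoning
      rearrange : ∀ a b t → a + (b + t) ≡ b + a + t
      rearrange = solve-∀

  runs-op : {o : Op n X} {k : X → Prog n B} (e : ℕ) →
            time (proj₂ (exec χ o σ)) ≡ e + time σ →
            Runs χ (k (proj₁ (exec χ o σ))) (proj₂ (exec χ o σ)) c Q →
            Runs χ (op o >>= k) σ (e + c) Q
  runs-op {σ = σ} {c = c} e eq (runs r t q) = runs (⇓bind ⇓op r) (begin
      _                   ≤⟨ t ⟩
      c + _               ≡⟨ cong (c +_) eq ⟩
      c + (e + time σ)    ≡⟨ rearrange c e (time σ) ⟩
      e + c + time σ      ∎) q
    where
      open ≤-Reasoning
      rearrange : ∀ a b t → a + (b + t) ≡ b + a + t
      rearrange = solve-∀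

  runs-read : {a : Array} {i : Fin n} {k : Cell n a → Prog n X} →
              Runs χ (k (memory σ a i)) (elapse 1 σ) c Q →
              Runs χ (op (read a i) >>= k) σ (1 + c) Q
  runs-read = runs-op 1 refl

  runs-read≡ : {a : Array} {i : Fin n} {k : Cell n a → Prog n X} {z : Cell n a} →
               memory σ a i ≡ z → Runs χ (k z) (elapse 1 σ) c Q →
               Runs χ (op (read a i) >>= k) σ (1 + c) Q
  runs-read≡ refl = runs-read

  runs-write : {a : Array} {i : Fin n} {z : Cell n a} {k : ⊤ → Prog n X} →
               Runs χ (k tt) (state (set (memory σ) a i z) (outputs σ) (1 + time σ)) c Q →
               Runs χ (op (write a i z) >>= k) σ (1 + c) Q
  runs-write = runs-op 1 refl

  runs-write⁰ : {a : Array} {i : Fin n} {z : Cell n a} {Q : ⊤ → Memory n → Outs n → Set} →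
                Q tt (set (memory σ) a i z) (outputs σ) →
                Runs χ (op (write a i z)) σ 1 Q
  runs-write⁰ q = runs ⇓op ≤-refl q

  runs-read⁰ : {a : Array} {i : Fin n} {Q : Cell n a → Memory n → Outs n → Set} →
               Q (memory σ a i) (memory σ) (outputs σ) →
               Runs χ (op (read a i)) σ 1 Q
  runs-read⁰ q = runs ⇓op ≤-refl q

  runs-output : {xs : List (Fin n)} {k : ⊤ → Prog n X} →
                Runs χ (k tt) (state (memory σ) (outputs σ ++ xs ∷ []) (1 + length xs + time σ)) c Q →
                Runs χ (op (output xs) >>= k) σ (1 + length xs + c) Q
  runs-output {xs = xs} = runs-op (1 + length xs) refl

  runs-choose : {x : Fin n} {xs : List (Fin n)} {k : Fin n × List (Fin n) → Prog n X} →
                (∀ i → Runs χ (k (lookup (x ∷ xs) i , removeAt (x ∷ xs) i))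
                              (elapse (length (x ∷ xs)) σ) c Q) →
                Runs χ (op (choose x xs) >>= k) σ (length (x ∷ xs) + c) Q
  runs-choose {σ = σ} {x = x} {xs = xs} r = runs-op (length (x ∷ xs)) refl (r (χ σ x xs))

  runs-again : {body : S → Prog n (S ⊎ X)} {s : S} {P : S → Memory n → Outs n → Set} →
               Runs χ (body s) σ c (λ r m o → ∃[ s′ ] r ≡ inj₁ s′ × P s′ m o) →
               (∀ s′ {σ′} → P s′ (memory σ′) (outputs σ′) → Runs χ (loop body s′) σ′ c′ Q) →
               Runs χ (loop body s) σ (suc (c + c′)) Q
  runs-again {σ = σ} {c = c} {c′ = c′} (runs {final = σ₁} r t (s′ , refl , p)) f
    with f s′ {elapse 1 σ₁} p
  ... | runs r′ t′ q = runs (⇓again r r′) (begin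
          _                         ≤⟨ t′ ⟩
          c′ + suc (time σ₁)        ≤⟨ +-monoʳ-≤ c′ (s≤s t) ⟩
          c′ + suc (c + time σ)     ≡⟨ rearrange c′ c (time σ) ⟩
          suc (c + c′) + time σ     ∎) q
    where
      open ≤-Reasoning
      rearrange : ∀ a b t → a + suc (b + t) ≡ suc (b + a) + t
      rearrange = solve-∀

  -- The invariant sees the entries still to come. Each entry pays one round on top of its own cost,
  -- and the leading `suc` pays for the round that meets the empty list.
  runs-fold : {f : B → Fin n → Prog n B} (I : B → List (Fin n) → Memory n → Outs n → Set)
              (k : Fin n → ℕ) →
              (∀ b x xs {σ} → I b (x ∷ xs) (memory σ) (outputs σ) →
                Runs χ (f b x) σ (k x) (λ b′ → I b′ xs)) →
              ∀ {b} xs → I b xs (memory σ) (outputs σ) →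
              Runs χ (fold f b xs) σ (suc (sum (map (suc ∘ k) xs))) (λ b → I b [])
  runs-fold I k step []       i = runs (⇓stop ⇓return) ≤-refl i
  runs-fold I k step (x ∷ xs) i = within (s≤s (≤-reflexive (rearrange (k x) _)))
    (runs-again {P = λ { (b , ys) m o → ys ≡ xs × I b xs m o }}
      (runs-bind (step _ x xs i) λ b p → runs-return (_ , refl , refl , p))
      λ { (b , ys) (refl , p) → runs-fold I k step xs p })
    where
      rearrange : ∀ a b → a + 0 + suc b ≡ suc (a + b)
      rearrange = solve-∀

  runs-foldᵘ : {f : B → Fin n → Prog n B} (I : B → List (Fin n) → Memory n → Outs n → Set)
               (k : ℕ) →
               (∀ b x xs {σ} → I b (x ∷ xs) (memory σ) (outputs σ) →
                 Runs χ (f b x) σ k (λ b′ → I b′ xs)) →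
               ∀ {b} xs → I b xs (memory σ) (outputs σ) →
               Runs χ (fold f b xs) σ (suc (length xs * suc k)) (λ b → I b [])
  runs-foldᵘ I k step xs i =
    within (s≤s (≤-reflexive (sum-map-const (suc k) xs))) (runs-fold I (λ _ → k) step xs i)

  runs-forEach : {f : Fin n → Prog n ⊤} (I : List (Fin n) → Memory n → Outs n → Set)
                 (k : ℕ) →
                 (∀ x xs {σ} → I (x ∷ xs) (memory σ) (outputs σ) →
                   Runs χ (f x) σ k (λ _ → I xs)) →
                 ∀ xs → I xs (memory σ) (outputs σ) →
                 Runs χ (forEach xs f) σ (suc (length xs * suc k)) (λ _ → I [])
  runs-forEach I k step = runs-foldᵘ (λ _ → I) k (λ _ → step)

  -- The accumulator reverses the order of the kept entries, hence a permutation rather than an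
  -- equation for `W`.
  runs-select : {test : Fin n → Prog n Bool} (p : Fin n → Bool) (k : ℕ) →
                (∀ x {σ′} → memory σ′ ≡ memory σ →
                  Runs χ (test x) σ′ k (λ b m o → b ≡ p x × m ≡ memory σ × o ≡ outputs σ′)) →
                ∀ xs → Runs χ (select test xs) σ (suc (length xs * suc k)) λ W m o →
                  W ↭ filter (λ x → p x ≟ᵇ true) xs × m ≡ memory σ × o ≡ outputs σ
  runs-select {σ = σ} {test = test} p k t xs = weaken ≤-refl
    (λ { (acc↭ , eqs) → ↭-trans (↭-sym (++-identityʳ _)) acc↭ , eqs })
    (runs-foldᵘ I k step xs (↭-refl , refl , refl))
    where
      flt : List (Fin n) → List (Fin n)
      flt = filter (λ x → p x ≟ᵇ true)

      I : List (Fin n) → List (Fin n) → Memory n → Outs n → Set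
      I acc rest m o = (acc ++ flt rest ↭ flt xs) × m ≡ memory σ × o ≡ outputs σ

      push : ∀ {b m o} acc x rest → I acc (x ∷ rest) m o → b ≡ p x →
             I (if b then x ∷ acc else acc) rest m o
      push acc x rest (i , eqs) refl with p x
      ... | true  = ↭-trans (↭-sym (shift x acc (flt rest))) i , eqs
      ... | false = i , eqs

      step : ∀ acc x rest {σ′} → I acc (x ∷ rest) (memory σ′) (outputs σ′) →
             Runs χ _ σ′ k (λ acc′ → I acc′ rest)
      step acc x rest (i , refl , refl) = within (≤-reflexive (+-identityʳ k))
        (runs-bind (t x refl) λ { b (b≡ , refl , refl) →
          runs-return (push acc x rest (i , refl , refl) b≡) })

-- Memory updates, finite subsets and sums

if-≟-≡ : {i j : Fin n} {x y : X} → i ≡ j → (if does (i ≟ᶠ j) then x else y) ≡ x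
if-≟-≡ {i = i} {j} i≡j with i ≟ᶠ j
... | yes _  = refl
... | no i≢j = contradiction i≡j i≢j

if-≟-≢ : {i j : Fin n} {x y : X} → i ≢ j → (if does (i ≟ᶠ j) then x else y) ≡ y
if-≟-≢ {i = i} {j} i≢j with i ≟ᶠ j
... | yes i≡j = contradiction i≡j i≢j
... | no _    = refl

set-≡ : (m : Memory n) (a : Array) {i j : Fin n} {z : Cell n a} → i ≡ j → set m a i z a j ≡ z
set-≡ m adj  = if-≟-≡
set-≡ m deg  = if-≟-≡
set-≡ m done = if-≟-≡
set-≡ m fwd  = if-≟-≡
set-≡ m nbr  = if-≟-≡
set-≡ m mark = if-≟-≡

set-≢ : (m : Memory n) (a : Array) {i j : Fin n} {z : Cell n a} → i ≢ j → set m a i z a j ≡ m a j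
set-≢ m adj  = if-≟-≢
set-≢ m deg  = if-≟-≢
set-≢ m done = if-≟-≢
set-≢ m fwd  = if-≟-≢
set-≢ m nbr  = if-≟-≢
set-≢ m mark = if-≟-≢

_∈?_ : (u : Fin n) (us : List (Fin n)) → Dec (u ∈ us)
_∈?_ = ∈-dec _≟ᶠ_

unique-++⁻ : (xs : List X) {ys : List X} → Unique (xs ++ ys) → Unique ys
unique-++⁻ []       u = u
unique-++⁻ (_ ∷ xs) u = unique-++⁻ xs (tail u)

∈-∷⁻ : {x y : X} {xs : List X} → x ∈ y ∷ xs → x ≢ y → x ∈ xs
∈-∷⁻ (here x≡y)   x≢y = contradiction x≡y x≢y
∈-∷⁻ (there x∈xs) _   = x∈xs

∈-tabulate⁺ : {P : Fin n → Set} (P? : ∀ u → Dec (P u)) {u : Fin n} →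
              P u → u ∈ˢ tabulate (λ u → does (P? u))
∈-tabulate⁺ P? {u} pu = lookup⇒[]= u _ (trans (lookup∘tabulate _ u) (lemma (P? u)))
  where
    lemma : ∀ d → does d ≡ true
    lemma (yes _)  = refl
    lemma (no ¬pu) = contradiction pu ¬pu

∈-tabulate⁻ : {P : Fin n → Set} (P? : ∀ u → Dec (P u)) {u : Fin n} →
              u ∈ˢ tabulate (λ u → does (P? u)) → P u
∈-tabulate⁻ P? {u} u∈ = lemma (P? u) (trans (sym (lookup∘tabulate _ u)) ([]=⇒lookup u∈))
  where
    lemma : ∀ d → does d ≡ true → _
    lemma (yes pu) _ = pu

-- Deleting the head from `p` makes `p` strictly smaller, and uniqueness keeps the tail inside what
-- is left.
length≤∣∣ : {xs : List (Fin n)} (p : Subset n) → Unique xs →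
            (∀ {x} → x ∈ xs → x ∈ˢ p) → length xs ≤ ∣ p ∣
length≤∣∣ {xs = []}     p _ _ = z≤n
length≤∣∣ {xs = x ∷ xs} p u f = ≤-trans
  (s≤s (length≤∣∣ (p - x) (tail u) λ {y} y∈xs →
    x∈p∧x≢y⇒x∈p-y (f (there y∈xs)) λ { refl → Unique[x∷xs]⇒x∉xs u y∈xs }))
  (x∈p⇒∣p-x∣<∣p∣ (f (here refl)))

length-allFin : ∀ n → length (allFin n) ≡ n
length-allFin n = length-tabulate {n = n} id

sum-map-affine : (k l : ℕ) (f : X → ℕ) (xs : List X) →
                 sum (map (λ x → k + l * f x) xs) ≡ length xs * k + l * sum (map f xs)
sum-map-affine k l f []       = sym (*-zeroʳ l)
sum-map-affine k l f (x ∷ xs) rewrite sum-map-affine k l f xs =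
  rearrange k l (f x) (length xs) (sum (map f xs))
  where
    rearrange : ∀ k l y a s → k + l * y + (a * k + l * s) ≡ k + a * k + l * (y + s)
    rearrange = solve-∀

-- The ordering

module Orderings {n : ℕ} (G : Graph n) (d : ℕ) where
  open Graph G

  degIn : List (Fin n) → Fin n → ℕ
  degIn us v = length (filter (E? v) us)

  ForwardAt : (Fin n → List (Fin n)) → Fin n → List (Fin n) → Set
  ForwardAt fw v vs = fw v ↭ filter (E? v) vs × degIn vs v ≤ d

  -- The requirement on an ordering as a recursion on its tails: positions disappear, and a vertex
  -- can be prepended.
  Forward : (Fin n → List (Fin n)) → List (Fin n) → Set
  Forward fw []       = ⊤
  Forward fw (v ∷ vs) = ForwardAt fw v vs × Forward fw vs

  Forward⇒N⁺ : ∀ {fw} vs → Forward fw vs →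
               ∀ i → fw (lookup vs i) ↭ N⁺ G vs i × length (N⁺ G vs i) ≤ d
  Forward⇒N⁺ (v ∷ vs) (f , fs) zero    = f
  Forward⇒N⁺ (v ∷ vs) (f , fs) (suc i) = Forward⇒N⁺ vs fs i

  N⁺⇒Forward : ∀ {fw} vs →
               (∀ i → fw (lookup vs i) ↭ N⁺ G vs i × length (N⁺ G vs i) ≤ d) → Forward fw vs
  N⁺⇒Forward []       f = tt
  N⁺⇒Forward (v ∷ vs) f = f zero , N⁺⇒Forward vs (f ∘ suc)

  -- rev lists the vertices placed so far, most recent first, and R the
  -- remaining ones.
  Removed : (Fin n → List (Fin n)) → List (Fin n) → List (Fin n) → Set
  Removed fw []        R = ⊤
  Removed fw (v ∷ rev) R = ForwardAt fw v R × Removed fw rev (v ∷ R)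

  -- The most recent removal precedes exactly `R` in the ordering, so it is moved to the front of
  -- `R` first; `ʳ++` does the same for the whole of `rev`.
  Removed⇒Forward : ∀ {fw} rev {R} → Removed fw rev R → Forward fw R → Forward fw (rev ʳ++ R)
  Removed⇒Forward []        _        fs = fs
  Removed⇒Forward (v ∷ rev) (r , rs) fs = Removed⇒Forward rev rs (r , fs)

  degIn-↭ : ∀ {R R′} v → R ↭ R′ → degIn R v ≡ degIn R′ v
  degIn-↭ v p = ↭-length (filter-↭ (E? v) p)

  -- `R` matters only as a collection: it is regrouped as `v ∷ R′` whenever `v` is taken from the
  -- worklist.
  Removed-resp-↭ : ∀ {fw} rev {R R′} → R ↭ R′ → Removed fw rev R → Removed fw rev R′
  Removed-resp-↭ []        p _                = tt
  Removed-resp-↭ (v ∷ rev) p ((f , ≤d) , rs) =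
    (↭-trans f (filter-↭ (E? v) p) , subst (_≤ d) (degIn-↭ v p) ≤d) ,
    Removed-resp-↭ rev (prep v p) rs

  Removed-cong : ∀ {fw fw′} rev {R} → (∀ {u} → u ∈ rev → fw′ u ≡ fw u) →
                 Removed fw rev R → Removed fw′ rev R
  Removed-cong []        eq _                = tt
  Removed-cong (v ∷ rev) eq ((f , ≤d) , rs) =
    (subst (_↭ _) (sym (eq (here refl))) f , ≤d) , Removed-cong rev (eq ∘ there) rs

  irreflexive : ∀ v → ¬ E v v
  irreflexive v = E-irrefl refl

  degIn-self : ∀ v us → degIn (v ∷ us) v ≡ degIn us v
  degIn-self v us = cong length (filter-reject (E? v) (irreflexive v))

  degIn-adjacent : ∀ {u v us} → E u v → degIn (v ∷ us) u ≡ suc (degIn us u)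
  degIn-adjacent {u} uv = cong length (filter-accept (E? u) uv)

  degIn-nonadjacent : ∀ {u v us} → ¬ E u v → degIn (v ∷ us) u ≡ degIn us u
  degIn-nonadjacent {u} ¬uv = cong length (filter-reject (E? u) ¬uv)

  degSum : List (Fin n) → List (Fin n) → ℕ
  degSum us ws = sum (map (degIn ws) us)

  -- By symmetry of `E`, the new entry `v` raises the degree of exactly those `u` in `us` that
  -- `degIn us v` counts.
  degSum-∷ : ∀ us v ws → degSum us (v ∷ ws) ≡ degIn us v + degSum us ws
  degSum-∷ []       v ws = refl
  degSum-∷ (u ∷ us) v ws with E? u v
  ... | yes uv rewrite degIn-adjacent {us = us} (E-sym uv) | degSum-∷ us v ws =
    cong suc (m+[n+o]≡n+[m+o] (degIn ws u) (degIn us v) (degSum us ws))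
  ... | no ¬uv rewrite degIn-nonadjacent {us = us} (¬uv ∘ E-sym) | degSum-∷ us v ws =
    m+[n+o]≡n+[m+o] (degIn ws u) (degIn us v) (degSum us ws)

  -- The head `v` brings its forward degree twice, as its own degree and through the degrees of its
  -- later neighbours; hence `d + d`.
  degSum≤ : ∀ {fw} vs → Forward fw vs → degSum vs vs ≤ length vs * (d + d)
  degSum≤ []       _               = z≤n
  degSum≤ (v ∷ vs) ((_ , ≤d) , fs) = begin
    degIn (v ∷ vs) v + degSum vs (v ∷ vs)     ≡⟨ cong₂ _+_ (degIn-self v vs) (degSum-∷ vs v vs) ⟩
    degIn vs v + (degIn vs v + degSum vs vs)  ≤⟨ +-mono-≤ ≤d (+-mono-≤ ≤d (degSum≤ vs fs)) ⟩
    d + (d + length vs * (d + d))             ≡⟨ sym (+-assoc d d _) ⟩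
    d + d + length vs * (d + d)               ∎
    where open ≤-Reasoning

  -- The one use of degeneracy. The subgraph induced by a non-empty `R` has a vertex of degree at
  -- most `d`, against `big`. So an empty worklist means that every vertex has been placed, and
  -- peeling cannot get stuck.
  all-placed : Degenerate G d → ∀ {R} → Unique R → (∀ {u} → u ∈ R → ¬ degIn R u ≤ d) → R ≡ []
  all-placed dg {[]}        _  _   = refl
  all-placed dg {R@(r ∷ _)} uR big with dg H (r , ∈-tabulate⁺ (_∈? R) (here refl))
    where
      H : Subgraph G
      H = record
        { vertices = tabulate (λ u → does (u ∈? R))
        ; Eᴴ       = λ u v → E u v × u ∈ R × v ∈ R
        ; Eᴴ?      = λ u v → E? u v ×-dec (u ∈? R ×-dec v ∈? R)
        ; Eᴴ-sym   = λ { (uv , u∈ , v∈) → E-sym uv , v∈ , u∈ }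
        ; Eᴴ⊆E     = proj₁
        ; Eᴴ-ends  = λ { (_ , u∈ , _) → ∈-tabulate⁺ (_∈? R) u∈ }
        }
  ... | v , v∈H , small = contradiction
    (≤-trans (length≤∣∣ _ (filter⁺ (E? v) uR) λ u∈ →
                let u∈R , vu = ∈-filter⁻ (E? v) u∈
                in ∈-tabulate⁺ (λ u → E? v u ×-dec (v ∈? R ×-dec u ∈? R)) (vu , v∈R , u∈R))
             small)
    (big v∈R)
    where
      v∈R : v ∈ R
      v∈R = ∈-tabulate⁻ (_∈? R) v∈H

≡ᵇ-true : ∀ j k → (j ≡ᵇ k) ≡ true → j ≡ k
≡ᵇ-true j k eq = ≡ᵇ⇒≡ j k (subst T (sym eq) tt)

≡ᵇ-false : ∀ j k → (j ≡ᵇ k) ≡ false → j ≢ k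
≡ᵇ-false j k eq j≡k = subst T eq (≡⇒≡ᵇ j k j≡k)

-- Correctness and cost of peeling

module Peeling {n : ℕ} (G : Graph n) (d : ℕ) (χ : Chooser n) (A : Fin n → List (Fin n))
               (A-unique : ∀ v → Unique (A v)) (A-edges : ∀ u v → v ∈ A u ⇔ Graph.E G u v) where
  open Graph G
  open Orderings G d

  runs-count : ∀ {σ} ns → Runs χ (count ns) σ (suc (length ns * 1)) λ k m o →
               k ≡ length ns × m ≡ memory σ × o ≡ outputs σ
  runs-count {σ} ns = weaken ≤-refl
    (λ { (eq , eqs) → trans (sym (+-identityʳ _)) eq , eqs })
    (runs-foldᵘ (λ k xs m o → k + length xs ≡ length ns × m ≡ memory σ × o ≡ outputs σ) 0
      (λ { k x xs (eq , eqs) → runs-return (trans (sym (+-suc k _)) eq , eqs) })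
      ns (refl , refl , refl))

  -- `done` and `deg` hold arbitrary values at first and are described only for the vertices already
  -- visited. `rest-unique` and `disjoint` keep repetitions out of the worklist.
  record Initialised (acc rest : List (Fin n)) (m : Memory n) (o : Outs n) : Set where
    field
      rest-unique : Unique rest
      acc-unique  : Unique acc
      disjoint    : ∀ {u} → u ∈ acc → u ∉ rest
      small       : ∀ {u} → u ∈ acc → length (A u) ≤ d
      processed   : ∀ u → u ∈ rest ⊎
                    (m done u ≡ false × m deg u ≡ length (A u) × (length (A u) ≤ d → u ∈ acc))
      adj≡        : ∀ u → m adj u ≡ A u
      silent      : o ≡ []

  initialised-step : ∀ {acc v rest m o} → Initialised acc (v ∷ rest) m o →
                     Initialised (if length (A v) ≤ᵇ d then v ∷ acc else acc) rest
                                 (set (set m done v false) deg v (length (A v))) o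
  initialised-step {acc} {v} {rest} {m} {o} I
    = cases (length (A v) ≤ᵇ d) refl
    where
      open Initialised I
      m′ : Memory n
      m′ = set (set m done v false) deg v (length (A v))

      v∉rest : v ∉ rest
      v∉rest = Unique[x∷xs]⇒x∉xs rest-unique

      processed′ : ∀ {acc′} → (∀ {u} → u ∈ acc → u ∈ acc′) → (length (A v) ≤ d → v ∈ acc′) →
                   ∀ u → u ∈ rest ⊎
                   (m′ done u ≡ false × m′ deg u ≡ length (A u) × (length (A u) ≤ d → u ∈ acc′))
      processed′ grow new u with v ≟ᶠ u
      ... | yes refl = inj₂ (refl , refl , new)
      ... | no v≢u with processed u
      ...   | inj₁ u∈ = inj₁ (∈-∷⁻ u∈ (v≢u ∘ sym))
      ...   | inj₂ (e₁ , e₂ , f) = inj₂ (e₁ , e₂ , grow ∘ f)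

      cases : ∀ b → (length (A v) ≤ᵇ d) ≡ b → Initialised (if b then v ∷ acc else acc) rest m′ o
      cases true eq = record
        { rest-unique = tail rest-unique
        ; acc-unique  = unique-∷ (λ v∈acc → disjoint v∈acc (here refl)) acc-unique
        ; disjoint    = λ { (here refl) → v∉rest ; (there u∈) → disjoint u∈ ∘ there }
        ; small       = λ { (here refl) → v-small ; (there u∈) → small u∈ }
        ; processed   = processed′ there (λ _ → here refl)
        ; adj≡        = adj≡
        ; silent      = silent
        }
        where
          v-small : length (A v) ≤ d
          v-small = ≤ᵇ⇒≤ _ _ (subst T (sym eq) tt)
      cases false eq = record
        { rest-unique = tail rest-unique
        ; acc-unique  = acc-unique
        ; disjoint    = λ u∈ → disjoint u∈ ∘ there
        ; small       = small
        ; processed   = processed′ (λ u∈ → u∈) (λ ≤d → contradiction (subst T eq (≤⇒≤ᵇ ≤d)) λ ())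
        ; adj≡        = adj≡
        ; silent      = silent
        }

  runs-initialise : ∀ acc v rest {σ} → Initialised acc (v ∷ rest) (memory σ) (outputs σ) →
                    Runs χ (initialise d v >>= λ b → return (if b then v ∷ acc else acc)) σ
                         (4 + 1 * length (A v)) (λ acc′ → Initialised acc′ rest)
  runs-initialise acc v rest {σ} I = within (≤-reflexive (rearrange (length (A v))))
    (runs-bind {P = λ b m o → b ≡ (length (A v) ≤ᵇ d) ×
                              m ≡ set (set (memory σ) done v false) deg v (length (A v)) ×
                              o ≡ outputs σ}
      (runs-write (runs-read≡ (Initialised.adj≡ I v) (runs-bind (runs-count (A v))
        λ { k (refl , refl , refl) → runs-write (runs-return (refl , refl , refl)) })))
      λ { b (refl , refl , refl) → runs-return (initialised-step I) })
    where
      rearrange : ∀ a → 1 + (1 + (suc (a * 1) + (1 + 0))) + 0 ≡ 4 + 1 * a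
      rearrange = solve-∀

  -- The arrays are separate parameters so that a write to another array
  -- preserves Base definitionally.
  record Base (rev R : List (Fin n)) (done′ : Fin n → Bool) (fwd′ adj′ : Fin n → List (Fin n))
              (o : Outs n) : Set where
    field
      partition : rev ++ R ↭ allFin n
      pending   : ∀ {u} → u ∈ R → done′ u ≡ false
      placed    : ∀ {u} → u ∈ rev → done′ u ≡ true
      removed   : Removed fwd′ rev R
      adj≡      : ∀ u → adj′ u ≡ A u
      silent    : o ≡ []

  -- Stated for the stored numbers and not for the true degrees, so that it also holds while the
  -- degrees are being lowered and some stored numbers are out of date.
  record Worklist (work R : List (Fin n)) (deg′ : Fin n → ℕ) : Set where
    field
      unique   : Unique work
      sound    : ∀ {u} → u ∈ work → u ∈ R × deg′ u ≤ d
      complete : ∀ {u} → u ∈ R → deg′ u ≤ d → u ∈ work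

  record Peeled (work rev R : List (Fin n)) (m : Memory n) (o : Outs n) : Set where
    field
      base     : Base rev R (m done) (m fwd) (m adj) o
      worklist : Worklist work R (m deg)
      degrees  : ∀ {u} → u ∈ R → m deg u ≡ degIn R u

  A↭ : ∀ v {R} → R ↭ allFin n → A v ↭ filter (E? v) R
  A↭ v {R} p = unique∧set⇒↭ (A-unique v) (filter⁺ (E? v) (unique-resp-↭ (↭-sym p) (allFin⁺ n)))
    (λ {u} u∈ → ∈-filter⁺ (E? v) (∈-resp-↭ (↭-sym p) (∈-allFin u)) (Equivalence.to (A-edges v u) u∈))
    (λ {u} u∈ → Equivalence.from (A-edges v u) (proj₂ (∈-filter⁻ (E? v) {xs = R} u∈)))

  initialised⇒peeled : ∀ {acc m o} → Initialised acc [] m o → Peeled acc [] (allFin n) m o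
  initialised⇒peeled {acc} {m} I = record
    { base = record
      { partition = ↭-refl
      ; pending   = λ {u} _ → proj₁ (all u)
      ; placed    = λ ()
      ; removed   = tt
      ; adj≡      = adj≡
      ; silent    = silent
      }
    ; worklist = record
      { unique   = acc-unique
      ; sound    = λ {u} u∈ → ∈-allFin u , subst (_≤ d) (sym (proj₁ (proj₂ (all u)))) (small u∈)
      ; complete = λ {u} _ ≤d → proj₂ (proj₂ (all u)) (subst (_≤ d) (proj₁ (proj₂ (all u))) ≤d)
      }
    ; degrees = λ {u} _ → trans (proj₁ (proj₂ (all u))) (↭-length (A↭ u ↭-refl))
    }
    where
      open Initialised I
      all : ∀ u → m done u ≡ false × m deg u ≡ length (A u) × (length (A u) ≤ d → u ∈ acc)
      all u with processed u
      ... | inj₂ p = p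

  -- Membership changes only when the number drops from `d + 1` to `d`. Before that drop `x` was
  -- above the threshold, so adding it creates no repetition.
  worklist-lower : ∀ {work R deg′ deg″ x j} → Worklist work R deg′ → x ∈ R →
                   deg′ x ≡ suc j → deg″ x ≡ j → (∀ {u} → x ≢ u → deg″ u ≡ deg′ u) →
                   Worklist (if suc j ≡ᵇ suc d then x ∷ work else work) R deg″
  worklist-lower {work} {R} {deg′} {deg″} {x} {j} L x∈R eq eq′ same with j ≡ᵇ d in test
  ... | true = record
    { unique   = unique-∷ (λ x∈ → 1+n≰n (subst (_≤ d) deg≡ (proj₂ (sound x∈)))) unique
    ; sound    = sound′
    ; complete = complete′
    }
    where
      open Worklist L
      j≡d : j ≡ d
      j≡d = ≡ᵇ-true j d test
      deg≡ : deg′ x ≡ suc d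
      deg≡ = trans eq (cong suc j≡d)
      sound′ : ∀ {u} → u ∈ x ∷ work → u ∈ R × deg″ u ≤ d
      sound′ {u} u∈ with x ≟ᶠ u
      ... | yes refl = x∈R , ≤-reflexive (trans eq′ j≡d)
      ... | no x≢u = let u∈R , ≤d = sound (∈-∷⁻ u∈ (x≢u ∘ sym)) in
                     u∈R , subst (_≤ d) (sym (same x≢u)) ≤d
      complete′ : ∀ {u} → u ∈ R → deg″ u ≤ d → u ∈ x ∷ work
      complete′ {u} u∈ ≤d with x ≟ᶠ u
      ... | yes refl = here refl
      ... | no x≢u = there (complete u∈ (subst (_≤ d) (same x≢u) ≤d))
  ... | false = record { unique = unique ; sound = sound′ ; complete = complete′ }
    where
      open Worklist L
      sound′ : ∀ {u} → u ∈ work → u ∈ R × deg″ u ≤ d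
      sound′ {u} u∈ with x ≟ᶠ u | sound u∈
      ... | yes refl | u∈R , ≤d = u∈R , subst (_≤ d) (sym eq′) (≤-trans (n≤1+n j) (subst (_≤ d) eq ≤d))
      ... | no x≢u   | u∈R , ≤d = u∈R , subst (_≤ d) (sym (same x≢u)) ≤d
      complete′ : ∀ {u} → u ∈ R → deg″ u ≤ d → u ∈ work
      complete′ {u} u∈ ≤d with x ≟ᶠ u
      -- `j ≤ d` and `j ≢ d` give `suc j ≤ d`: the old number was already small, so `x` is on the
      -- worklist.
      ... | yes refl = complete u∈ (subst (_≤ d) (sym eq) (≤∧≢⇒< (subst (_≤ d) eq′ ≤d) (≡ᵇ-false j d test)))
      ... | no x≢u = complete u∈ (subst (_≤ d) (same x≢u) ≤d)

  -- The situation between a removal and the update of the last neighbour: entries of `us` still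
  -- count the removed vertex, hence the `suc` in `high`.
  record Lowering (rev R work us : List (Fin n)) (m : Memory n) (o : Outs n) : Set where
    field
      base      : Base rev R (m done) (m fwd) (m adj) o
      worklist  : Worklist work R (m deg)
      us-unique : Unique us
      us⊆R      : ∀ {u} → u ∈ us → u ∈ R
      high      : ∀ {u} → u ∈ us → m deg u ≡ suc (degIn R u)
      exact     : ∀ {u} → u ∈ R → u ∉ us → m deg u ≡ degIn R u

  runs-lower : ∀ {rev R} work x us {σ} → Lowering rev R work (x ∷ us) (memory σ) (outputs σ) →
               Runs χ (lower d work x) σ 2 (λ work′ → Lowering rev R work′ us)
  runs-lower {R = R} work x us {σ} I = runs-read≡ (high (here refl)) (runs-write (runs-return record
    { base      = base
    ; worklist  = worklist-lower worklist (us⊆R (here refl)) (high (here refl))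
                    (set-≡ m deg refl) (set-≢ m deg)
    ; us-unique = tail us-unique
    ; us⊆R      = us⊆R ∘ there
    ; high      = λ u∈ → trans (set-≢ m deg {x} (λ { refl → x∉us u∈ })) (high (there u∈))
    ; exact     = exact′
    }))
    where
      open Lowering I
      m : Memory n
      m = memory σ
      x∉us : x ∉ us
      x∉us = Unique[x∷xs]⇒x∉xs us-unique
      exact′ : ∀ {u} → u ∈ R → u ∉ us → set m deg x (degIn R x) deg u ≡ degIn R u
      exact′ {u} u∈ u∉ with x ≟ᶠ u
      ... | yes refl = refl
      ... | no x≢u = exact u∈ λ u∈x∷us → u∉ (∈-∷⁻ u∈x∷us (x≢u ∘ sym))

  remaining-unique : ∀ {rev R done′ fwd′ adj′ o} → Base rev R done′ fwd′ adj′ o → Unique R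
  remaining-unique {rev} b =
    unique-++⁻ rev (unique-resp-↭ (↭-sym (Base.partition b)) (allFin⁺ n))

  runs-remaining : ∀ {m₀} x {σ′} → memory σ′ ≡ m₀ →
                   Runs χ (remaining d x) σ′ 1 λ b m o →
                     b ≡ not (m₀ done x) × m ≡ m₀ × o ≡ outputs σ′
  runs-remaining x refl = runs-read (runs-return (refl , refl , refl))

  module Removal {v : Fin n} {work rev R R′ : List (Fin n)} {m : Memory n} {o : Outs n}
                 (I : Peeled (v ∷ work) rev R m o) (R↭ : R ↭ v ∷ R′) where
    open Peeled I
    open Base base
    open Worklist worklist

    done′ : Fin n → Bool
    done′ = set m done v true done

    partition′ : v ∷ (rev ++ R′) ↭ allFin n
    partition′ = ↭-trans (↭-sym (shift v rev R′)) (↭-trans (++⁺ˡ rev (↭-sym R↭)) partition)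

    all-unique : Unique (v ∷ (rev ++ R′))
    all-unique = unique-resp-↭ (↭-sym partition′) (allFin⁺ n)

    v∉rev : v ∉ rev
    v∉rev = Unique[x∷xs]⇒x∉xs all-unique ∘ ∈-++⁺ˡ

    v∉R′ : v ∉ R′
    v∉R′ = Unique[x∷xs]⇒x∉xs all-unique ∘ ∈-++⁺ʳ rev

    R′⊆R : ∀ {u} → u ∈ R′ → u ∈ R
    R′⊆R u∈ = ∈-resp-↭ (↭-sym R↭) (there u∈)

    R′-unique : Unique R′
    R′-unique = tail (unique-resp-↭ R↭ (remaining-unique base))

    pending′ : ∀ {u} → u ∈ R′ → done′ u ≡ false
    pending′ u∈ = trans (set-≢ m done {v} (λ { refl → v∉R′ u∈ })) (pending (R′⊆R u∈))

    placed′ : ∀ {u} → u ∈ v ∷ rev → done′ u ≡ true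
    placed′ {u} u∈ with v ≟ᶠ u
    ... | yes refl = refl
    ... | no v≢u   = placed (∈-∷⁻ u∈ (v≢u ∘ sym))

    unplaced : ∀ {u} → done′ u ≡ false → u ∈ R′
    unplaced {u} eq with ∈-++⁻ (v ∷ rev) (∈-resp-↭ (↭-sym partition′) (∈-allFin u))
    ... | inj₁ u∈ = contradiction (trans (sym eq) (placed′ u∈)) λ ()
    ... | inj₂ u∈ = u∈

    unplaced? : ∀ u → Dec (not (done′ u) ≡ true)
    unplaced? u = not (done′ u) ≟ᵇ true

    -- Both sides are free of repetitions, and by `partition` a vertex that is not done lies in
    -- `R′`, so they have the same members.
    remaining↭ : filter unplaced? (A v) ↭ filter (E? v) R′
    remaining↭ = unique∧set⇒↭ (filter⁺ unplaced? (A-unique v)) (filter⁺ (E? v) R′-unique)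
      (λ {u} u∈ → let u∈A , eq = ∈-filter⁻ unplaced? {xs = A v} u∈ in
        ∈-filter⁺ (E? v) (unplaced (not-true eq)) (Equivalence.to (A-edges v u) u∈A))
      (λ {u} u∈ → let u∈R′ , vu = ∈-filter⁻ (E? v) {xs = R′} u∈ in
        ∈-filter⁺ unplaced? (Equivalence.from (A-edges v u) vu) (cong not (pending′ u∈R′)))
      where
        not-true : ∀ {b} → not b ≡ true → b ≡ false
        not-true {false} _ = refl

    -- The worklist bounds the degree of `v` in `R`, and leaving out `v` itself changes nothing
    -- because `v` is not its own neighbour.
    v-small : degIn R′ v ≤ d
    v-small = let v∈R , ≤d = sound (here refl) in
      subst (_≤ d) (trans (degrees v∈R) (trans (degIn-↭ v R↭) (degIn-self v R′))) ≤d

    module _ {ws : List (Fin n)} (ws↭ : ws ↭ filter (E? v) R′) where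

      lowering : Lowering (v ∷ rev) R′ work ws (set (set m done v true) fwd v ws) o
      lowering = record
        { base = record
          { partition = partition′
          ; pending   = pending′
          ; placed    = placed′
          ; removed   = (subst (_↭ _) (sym (set-≡ m fwd {v} refl)) ws↭ , v-small)
                      , Removed-cong rev (λ u∈ → set-≢ m fwd {v} (λ { refl → v∉rev u∈ }))
                          (Removed-resp-↭ rev R↭ removed)
          ; adj≡      = adj≡
          ; silent    = silent
          }
        ; worklist = record
          { unique   = tail unique
          ; sound    = λ u∈ → let u∈R , ≤d = sound (there u∈) in
                       ∈-∷⁻ (∈-resp-↭ R↭ u∈R) (λ { refl → Unique[x∷xs]⇒x∉xs unique u∈ }) , ≤d
          ; complete = λ u∈ ≤d → ∈-∷⁻ (complete (R′⊆R u∈) ≤d) λ { refl → v∉R′ u∈ }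
          }
        ; us-unique = unique-resp-↭ (↭-sym ws↭) (filter⁺ (E? v) R′-unique)
        ; us⊆R      = proj₁ ∘ ws⁻
        ; high      = λ u∈ → let u∈R′ , vu = ws⁻ u∈ in
                      trans (deg≡ u∈R′) (degIn-adjacent (E-sym vu))
        ; exact     = λ u∈ u∉ → trans (deg≡ u∈) (degIn-nonadjacent λ uv →
                      u∉ (∈-resp-↭ (↭-sym ws↭) (∈-filter⁺ (E? v) u∈ (E-sym uv))))
        }
        where
          ws⁻ : ∀ {u} → u ∈ ws → u ∈ R′ × E v u
          ws⁻ u∈ = ∈-filter⁻ (E? v) {xs = R′} (∈-resp-↭ ws↭ u∈)
          deg≡ : ∀ {u} → u ∈ R′ → m deg u ≡ degIn (v ∷ R′) u
          deg≡ {u} u∈ = trans (degrees (R′⊆R u∈)) (degIn-↭ u R↭)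

  lowered⇒peeled : ∀ {rev R work m o} → Lowering rev R work [] m o → Peeled work rev R m o
  lowered⇒peeled I = record { base = base ; worklist = worklist ; degrees = λ u∈ → exact u∈ λ () }
    where open Lowering I

  runs-remove : ∀ {σ v work rev R R′} → Peeled (v ∷ work) rev R (memory σ) (outputs σ) → R ↭ v ∷ R′ →
                Runs χ (remove d (v ∷ work , rev)) σ (5 + 5 * length (A v)) λ r m o →
                  ∃[ s ] r ≡ inj₁ s × proj₂ s ≡ v ∷ rev × Peeled (proj₁ s) (v ∷ rev) R′ m o
  runs-remove {v = v} {work} I R↭ = within (≤-reflexive (rearrange (length (A v))))
    (runs-write (runs-read≡ (Base.adj≡ (Peeled.base I) v) (runs-bind
      (runs-select _ 1 runs-remaining (A v))
      λ { ws (ws↭ , refl , refl) → runs-write (runs-bind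
        -- `ws` is a selection from `A v`, so both loops are charged to `length (A v)`: 2 per entry
        -- for selecting and 3 for lowering.
        (within (s≤s (*-monoˡ-≤ 3 (≤-trans (≤-reflexive (↭-length ws↭)) (length-filter _ (A v)))))
          (runs-foldᵘ (Lowering _ _) 2 runs-lower ws (lowering (↭-trans ws↭ remaining↭))))
        λ work′ J → runs-return (_ , refl , refl , lowered⇒peeled J)) })))
    where
      open Removal I R↭
      rearrange : ∀ a → 1 + (1 + (suc (a * 2) + (1 + (suc (a * 3) + 0)))) ≡ 5 + 5 * a
      rearrange = solve-∀

  peelCost : Fin n → ℕ
  peelCost v = 6 + 5 * length (A v)

  -- The recursion is on `k`, since `R′` is obtained by permuting `R` and is no structural part of
  -- it. The cost is a sum over `R`, which a permutation leaves unchanged.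
  runs-peel-loop : Degenerate G d → ∀ k {σ work rev R} → length R ≡ k →
                   Peeled work rev R (memory σ) (outputs σ) →
                   Runs χ (loop (remove d) (work , rev)) σ (suc (sum (map peelCost R))) λ rev′ m o →
                     ∃[ work′ ] Peeled work′ rev′ [] m o
  runs-peel-loop dg k {work = []} {R = R} len I with all-placed dg (remaining-unique base) big
    where
      open Peeled I
      big : ∀ {u} → u ∈ R → ¬ degIn R u ≤ d
      big u∈ small
        with () ← Worklist.complete worklist u∈ (subst (_≤ d) (sym (degrees u∈)) small)
  ... | refl = runs (⇓stop ⇓return) ≤-refl (_ , I)
  runs-peel-loop dg k {work = v ∷ work} {R = R} len I
    with R′ , R↭ ← ∈⇒↭∷ (proj₁ (Worklist.sound (Peeled.worklist I) (here refl)))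
    with k | trans (sym len) (↭-length R↭)
  ... | suc k | eq = within
    (≤-reflexive (trans (rearrange (length (A v)) (sum (map peelCost R′)))
                        (cong suc (sym (sum-↭ (map⁺ peelCost R↭))))))
    (runs-again (runs-remove I R↭) λ { (work′ , rev′) (refl , J) →
      runs-peel-loop dg k (sym (suc-injective eq)) J })
    where
      rearrange : ∀ a s → 1 + (5 + 5 * a + (1 + s)) ≡ 1 + (6 + 5 * a + s)
      rearrange = solve-∀

  runs-reversed : ∀ {σ} xs → Runs χ (reversed xs) σ (suc (length xs * 1)) λ ys m o →
                  ys ≡ xs ʳ++ [] × m ≡ memory σ × o ≡ outputs σ
  runs-reversed {σ} xs = runs-foldᵘ
    (λ acc rest m o → rest ʳ++ acc ≡ xs ʳ++ [] × m ≡ memory σ × o ≡ outputs σ) 0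
    (λ _ _ _ → runs-return) xs (refl , refl , refl)

  adjSum : ℕ
  adjSum = sum (map (length ∘ A) (allFin n))

  -- The running time is first expressed by the sum of all degrees; the ordering that the run has
  -- produced then bounds this sum.
  adjSum≤ : ∀ {fw vs} → vs ↭ allFin n → Forward fw vs → adjSum ≤ n * (d + d)
  adjSum≤ {vs = vs} vs↭ fs = begin
    adjSum                                 ≡⟨ sum-↭ (map⁺ (length ∘ A) (↭-sym vs↭)) ⟩
    sum (map (length ∘ A) vs)              ≡⟨ cong sum (map-cong (λ v → ↭-length (A↭ v vs↭)) vs) ⟩
    degSum vs vs                           ≤⟨ degSum≤ vs fs ⟩
    length vs * (d + d)                    ≡⟨ cong (_* (d + d)) (trans (↭-length vs↭) (length-allFin n)) ⟩
    n * (d + d)                            ∎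
    where open ≤-Reasoning

  -- Initialising takes `5 * n + adjSum`, removing `6 * n + 5 * adjSum`, reversing `n`, and each of
  -- the three loops has one closing round.
  runs-peel : ∀ {σ} → Degenerate G d → (∀ v → memory σ adj v ≡ A v) → outputs σ ≡ [] →
              Runs χ (peel d) σ (3 + 12 * n + 6 * adjSum) λ vs m o →
                vs ↭ allFin n × Forward (m fwd) vs × o ≡ []
  runs-peel {σ} dg adj≡ silent = within (≤-reflexive total)
    (runs-bind
      (runs-fold Initialised (λ v → 4 + 1 * length (A v)) runs-initialise (allFin n) record
        { rest-unique = allFin⁺ n
        ; acc-unique  = []
        ; disjoint    = λ ()
        ; small       = λ ()
        ; processed   = λ u → inj₁ (∈-allFin u)
        ; adj≡        = adj≡
        ; silent      = silent
        })
      λ work I → runs-bind (runs-peel-loop dg _ refl (initialised⇒peeled I))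
      λ { rev (_ , J) → let open Base (Peeled.base J) in weaken
            (s≤s (*-monoˡ-≤ 1 (≤-reflexive
              (trans (↭-length (↭-trans (↭-sym (++-identityʳ rev)) partition)) (length-allFin n)))))
            (λ { (refl , refl , refl) →
                 ↭-trans (↭-sym (++↭ʳ++ rev [])) partition
               , Removed⇒Forward rev removed tt
               , Base.silent (Peeled.base J) })
            (runs-reversed rev) })
    where
      total : suc (sum (map (λ v → 5 + 1 * length (A v)) (allFin n))) +
              (suc (sum (map peelCost (allFin n))) + suc (n * 1)) ≡ 3 + 12 * n + 6 * adjSum
      total rewrite sum-map-affine 5 1 (length ∘ A) (allFin n)
                  | sum-map-affine 6 5 (length ∘ A) (allFin n)
                  | length-allFin n = rearrange n adjSum
        where
          rearrange : ∀ n s → suc (n * 5 + 1 * s) + (suc (n * 6 + 5 * s) + suc (n * 1)) ≡ 3 + 12 * n + 6 * s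
          rearrange = solve-∀

1≤m*n : ∀ {a b} → 1 ≤ a → 1 ≤ b → 1 ≤ a * b
1≤m*n = *-mono-≤ {1} {_} {1}

1≤2^ : ∀ d → 1 ≤ 2 ^ d
1≤2^ = m^n>0 2

dn≤d2ᵈn : ∀ d n → d * n ≤ d * 2 ^ d * n
dn≤d2ᵈn d n = *-monoˡ-≤ n (subst (_≤ d * 2 ^ d) (*-identityʳ d) (*-monoʳ-≤ d (1≤2^ d)))

-- `27 = 3 + 12 + 6 * 2`: the constant and the multiple of `n` are raised to multiples of `d * n`,
-- and the degrees sum to at most `2 * (d * n)`.
peel-computesOrdering : ComputesOrdering peel 27
peel-computesOrdering n d G χ σ 1≤n dg input = value , final , run
  , (vs↭ , proj₂ ∘ Forward⇒N⁺ value fs) , proj₁ ∘ Forward⇒N⁺ value fs , silent , bound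
  where
    open Input input
    open Orderings G d
    open Peeling G d χ (memory σ adj) adj-unique adj-edges
    open Runs (runs-peel {σ} dg (λ _ → refl) no-outputs)
    vs↭ = proj₁ post
    fs = proj₁ (proj₂ post)
    silent = proj₂ (proj₂ post)
    open ≤-Reasoning
    bound : TimeBound 27 d n (time final)
    bound 1≤d = begin
      time final                                            ≤⟨ cost ⟩
      3 + 12 * n + 6 * adjSum + time σ                      ≡⟨ cong (3 + 12 * n + 6 * adjSum +_) at-start ⟩
      3 + 12 * n + 6 * adjSum + 0                           ≤⟨ +-monoˡ-≤ 0 (+-mono-≤
        (+-mono-≤ (*-monoʳ-≤ 3 (1≤m*n 1≤d 1≤n))
                  (*-monoʳ-≤ 12 (subst (_≤ d * n) (*-identityˡ n) (*-monoˡ-≤ n 1≤d))))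
        (*-monoʳ-≤ 6 (adjSum≤ vs↭ fs))) ⟩
      3 * (d * n) + 12 * (d * n) + 6 * (n * (d + d)) + 0    ≡⟨ rearrange d n ⟩
      27 * (d * n)                                          ≤⟨ *-monoʳ-≤ 27 (dn≤d2ᵈn d n) ⟩
      27 * (d * 2 ^ d * n)                                  ∎
      where
        rearrange : ∀ d n → 3 * (d * n) + 12 * (d * n) + 6 * (n * (d + d)) + 0 ≡ 27 * (d * n)
        rearrange = solve-∀

-- Listing the cliques

⋃⁺ : {u : Fin n} {xs : List (Fin n)} → u ∈ xs → u ∈ˢ ⋃ (map ⁅_⁆ xs)
⋃⁺ (here refl) = x∈p∪q⁺ (inj₁ (x∈⁅x⁆ _))
⋃⁺ (there u∈)  = x∈p∪q⁺ (inj₂ (⋃⁺ u∈))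

⋃⁻ : {u : Fin n} (xs : List (Fin n)) → u ∈ˢ ⋃ (map ⁅_⁆ xs) → u ∈ xs
⋃⁻ []       u∈ = contradiction u∈ ∉⊥
⋃⁻ (x ∷ xs) u∈ with x∈p∪q⁻ ⁅ x ⁆ _ u∈
... | inj₁ u∈x  = here (x∈⁅y⁆⇒x≡y x u∈x)
... | inj₂ u∈xs = there (⋃⁻ xs u∈xs)

-- Marking and unmarking along a list

marked : Memory n → Bool → List (Fin n) → Memory n
marked m b []       = m
marked m b (u ∷ us) = marked (set m mark u b) b us

marked-nbr : ∀ (m : Memory n) b us v → marked m b us nbr v ≡ m nbr v
marked-nbr m b []       v = refl
marked-nbr m b (u ∷ us) v = marked-nbr (set m mark u b) b us v

marked-fwd : ∀ (m : Memory n) b us v → marked m b us fwd v ≡ m fwd v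
marked-fwd m b []       v = refl
marked-fwd m b (u ∷ us) v = marked-fwd (set m mark u b) b us v

marked-∉ : ∀ (m : Memory n) b us {v} → v ∉ us → marked m b us mark v ≡ m mark v
marked-∉ m b []       v∉ = refl
marked-∉ m b (u ∷ us) v∉ =
  trans (marked-∉ (set m mark u b) b us (v∉ ∘ there)) (set-≢ m mark {u} λ { refl → v∉ (here refl) })

marked-∈ : ∀ (m : Memory n) b us {v} → v ∈ us → marked m b us mark v ≡ b
marked-∈ m b (u ∷ us) {v} v∈ with v ∈? us
... | yes v∈us = marked-∈ _ b us v∈us
... | no  v∉us = trans (marked-∉ _ b us v∉us) (set-≡ m mark {u} (u≡v v∈))
  where
    u≡v : v ∈ u ∷ us → u ≡ v
    u≡v (here v≡u)   = sym v≡u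
    u≡v (there v∈us) = contradiction v∈us v∉us

runs-mark : ∀ {χ : Chooser n} {σ} b us →
            Runs χ (forEach us (λ u → op (write mark u b))) σ (suc (length us * 2)) λ _ m o →
              m ≡ marked (memory σ) b us × o ≡ outputs σ
runs-mark {σ = σ} b us = runs-forEach
  (λ rest m o → marked m b rest ≡ marked (memory σ) b us × o ≡ outputs σ) 1
  (λ _ _ → runs-write⁰) us (refl , refl)

-- Counting how often a vertex is linked

δ : Fin n → Fin n → ℕ
δ x u = if does (u ≟ᶠ x) then 1 else 0

-- Shaped like `set` on `nbr`, so that two pushes are definitionally the contents of `nbr` after
-- `link`.
push : (Fin n → List (Fin n)) → Fin n → Fin n → Fin n → List (Fin n)
push f u w x = if does (u ≟ᶠ x) then w ∷ f u else f x

module _ (f : Fin n → List (Fin n)) (u w : Fin n) where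

  push-new : w ∈ push f u w u
  push-new rewrite if-≟-≡ {i = u} {x = w ∷ f u} {f u} refl = here refl

  push-old : ∀ {x z} → z ∈ f x → z ∈ push f u w x
  push-old {x} z∈ with u ≟ᶠ x
  ... | yes refl = there z∈
  ... | no _     = z∈

  push⁻ : ∀ {x z} → z ∈ push f u w x → z ∈ f x ⊎ (x ≡ u × z ≡ w)
  push⁻ {x} z∈ with u ≟ᶠ x
  push⁻ {x} (here refl) | yes refl = inj₂ (refl , refl)
  push⁻ {x} (there z∈)  | yes refl = inj₁ z∈
  push⁻ {x} z∈          | no _     = inj₁ z∈

  length-push : ∀ x → length (push f u w x) ≡ δ x u + length (f x)
  length-push x with u ≟ᶠ x
  ... | yes refl = refl
  ... | no _     = refl

δ-sum-∉ : ∀ (x : Fin n) us → x ∉ us → sum (map (δ x) us) ≡ 0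
δ-sum-∉ x []       x∉ = refl
δ-sum-∉ x (u ∷ us) x∉ =
  cong₂ _+_ (if-≟-≢ {i = u} {x} λ { refl → x∉ (here refl) }) (δ-sum-∉ x us (x∉ ∘ there))

δ-sum≤1 : ∀ (x : Fin n) {us} → Unique us → sum (map (δ x) us) ≤ 1
δ-sum≤1 x {[]}     _ = z≤n
δ-sum≤1 x {u ∷ us} un with u ≟ᶠ x
... | yes refl = ≤-reflexive (cong suc (δ-sum-∉ x us (Unique[x∷xs]⇒x∉xs un)))
... | no _     = δ-sum≤1 x (tail un)

-- Upper bounds for the number of times x can still be linked while the lists
-- ws (of u), resp. fw u for u in us, are processed.
listLinks : Fin n → List (Fin n) → Fin n → ℕ
listLinks u ws x = sum (map (λ w → δ x u + δ x w) ws)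

links : (Fin n → List (Fin n)) → List (Fin n) → Fin n → ℕ
links fw us x = sum (map (λ u → listLinks u (fw u) x) us)

listLinks≡ : ∀ (u : Fin n) ws x → listLinks u ws x ≡ length ws * δ x u + sum (map (δ x) ws)
listLinks≡ u []       x = refl
listLinks≡ u (w ∷ ws) x rewrite listLinks≡ u ws x =
  rearrange (δ x u) (δ x w) (length ws * δ x u) (sum (map (δ x) ws))
  where
    rearrange : ∀ a b c s → a + b + (c + s) ≡ a + c + (b + s)
    rearrange = solve-∀

-- An occurrence of `x` in `us` contributes the at most `d` entries of its own list; every list
-- `fw u` is free of repetitions and contributes at most one more.
links≤ : ∀ {fw : Fin n → List (Fin n)} {d} → (∀ u → Unique (fw u)) → (∀ u → length (fw u) ≤ d) →
         ∀ us x → links fw us x ≤ d * sum (map (δ x) us) + length us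
links≤ un ≤d []       x = z≤n
links≤ {fw = fw} {d} un ≤d (u ∷ us) x = begin
  listLinks u (fw u) x + links fw us x
    ≡⟨ cong (_+ links fw us x) (listLinks≡ u (fw u) x) ⟩
  length (fw u) * δ x u + sum (map (δ x) (fw u)) + links fw us x
    ≤⟨ +-mono-≤ (+-mono-≤ (*-monoˡ-≤ (δ x u) (≤d u)) (δ-sum≤1 x (un u))) (links≤ un ≤d us x) ⟩
  d * δ x u + 1 + (d * sum (map (δ x) us) + length us)
    ≡⟨ rearrange d (δ x u) (sum (map (δ x) us)) (length us) ⟩
  d * (δ x u + sum (map (δ x) us)) + (1 + length us)
    ∎
  where
    open ≤-Reasoning
    rearrange : ∀ d a s l → d * a + 1 + (d * s + l) ≡ d * (a + s) + (1 + l)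
    rearrange = solve-∀

-- Branching search for the cliques inside a vertex set

module Cliques {n : ℕ} (G : Graph n) (χ : Chooser n) (fw : Fin n → List (Fin n)) where
  open Graph G

  CliqueList : List (Fin n) → Set
  CliqueList xs = ∀ {u v} → u ∈ xs → v ∈ xs → u ≢ v → E u v

  Sound : Outs n → Set
  Sound o = ∀ {ys} → ys ∈ o → CliqueList ys

  Listed : Outs n → Subset n → Set
  Listed o S = ∃[ ys ] ys ∈ o × (∀ {u} → u ∈ ys → u ∈ˢ S) × (∀ {u} → u ∈ˢ S → u ∈ ys)

  _⊑_ : Outs n → Outs n → Set
  o ⊑ o′ = ∀ {ys} → ys ∈ o → ys ∈ o′

  Listed-mono : ∀ {o o′ S} → o ⊑ o′ → Listed o S → Listed o′ S
  Listed-mono o⊑o′ (ys , ys∈ , eqs) = ys , o⊑o′ ys∈ , eqs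

  ListsWithin : Outs n → List (Fin n) → Set
  ListsWithin o F = ∀ S → IsClique G S → (∀ {u} → u ∈ˢ S → u ∈ F) → Listed o S

  Sound-∷ʳ : ∀ {o xs} → Sound o → CliqueList xs → Sound (o ++ xs ∷ [])
  Sound-∷ʳ {o} so cl ys∈ with ∈-++⁻ o ys∈
  ... | inj₁ ys∈o        = so ys∈o
  ... | inj₂ (here refl) = cl

  -- All marks are off between calls, so an intersection restores `mark` by unmarking the list it
  -- marked, at a cost independent of `n`.
  record Ready (nb : Fin n → List (Fin n)) (m : Memory n) : Set where
    field
      clear : ∀ u → m mark u ≡ false
      nbr≡  : ∀ u → m nbr u ≡ nb u
      fwd≡  : ∀ u → m fwd u ≡ fw u

  module Enumeration (F : List (Fin n)) (nb : Fin n → List (Fin n))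
                     (nb-edges : ∀ {x u} → x ∈ F → u ∈ F → u ∈ nb x ⇔ E x u)
                     (L : ℕ) (nb-length : ∀ {x} → x ∈ F → length (nb x) ≤ L) where

    ready-∩N : ∀ {m} ns → Ready nb m → Ready nb (marked (marked m true ns) false ns)
    ready-∩N {m} ns r = record
      { clear = clear′
      ; nbr≡  = λ u → trans (marked-nbr _ false ns u) (trans (marked-nbr m true ns u) (nbr≡ u))
      ; fwd≡  = λ u → trans (marked-fwd _ false ns u) (trans (marked-fwd m true ns u) (fwd≡ u))
      }
      where
        open Ready r
        clear′ : ∀ u → marked (marked m true ns) false ns mark u ≡ false
        clear′ u with u ∈? ns
        ... | yes u∈ = marked-∈ _ false ns u∈
        ... | no  u∉ = trans (marked-∉ _ false ns u∉) (trans (marked-∉ m true ns u∉) (clear u))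

    -- Marking and unmarking walk along the list of `x`, together `4 * L`; testing walks along `V`.
    runs-∩N : ∀ {σ x} V → x ∈ F → Ready nb (memory σ) →
              Runs χ (V ∩N x) σ (4 + 2 * length V + 4 * L) λ W m o →
                W ↭ filter (_∈? nb x) V × Ready nb m × o ≡ outputs σ
    runs-∩N {σ} {x} V x∈F r = within bound
      (runs-read≡ (nbr≡ x) (runs-bind (runs-mark true ns) λ { _ (refl , refl) →
        runs-bind (runs-select (marked (memory σ) true ns mark) 1
                    (λ { u refl → runs-read⁰ (refl , refl , refl) }) V)
        λ { W (W↭ , refl , refl) → runs-bind (runs-mark false ns)
        λ { _ (refl , refl) → runs-return
          ( ↭-trans W↭ (↭-reflexive (filter-≐ _ (_∈? ns) (to , from) V))
          , ready-∩N ns r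
          , refl ) } } }))
      where
        open Ready r
        ns : List (Fin n)
        ns = nb x
        to : ∀ {u} → marked (memory σ) true ns mark u ≡ true → u ∈ ns
        to {u} eq with u ∈? ns
        ... | yes u∈ = u∈
        ... | no  u∉ = contradiction (trans (sym eq) (trans (marked-∉ _ true ns u∉) (clear u))) λ ()
        from : ∀ {u} → u ∈ ns → marked (memory σ) true ns mark u ≡ true
        from u∈ = marked-∈ _ true ns u∈
        open ≤-Reasoning
        bound : 1 + (suc (length ns * 2) + (suc (length V * 2) + (suc (length ns * 2) + 0))) ≤
                4 + 2 * length V + 4 * L
        bound = begin
          _                                   ≡⟨ rearrange (length ns) (length V) ⟩
          4 + 2 * length V + 4 * length ns    ≤⟨ +-monoʳ-≤ (4 + 2 * length V) (*-monoʳ-≤ 4 (nb-length x∈F)) ⟩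
          4 + 2 * length V + 4 * L            ∎
          where
            rearrange : ∀ a v → 1 + (suc (a * 2) + (suc (v * 2) + (suc (a * 2) + 0))) ≡ 4 + 2 * v + 4 * a
            rearrange = solve-∀

    module _ (D : ℕ) where

      -- Covers choosing from `V`, writing out `x ∷ xs` and intersecting, given that `xs` and `V`
      -- together have at most `D` entries.
      roundCost : ℕ
      roundCost = 5 + 4 * D + 4 * L

      -- One round followed by two branches on shorter lists; at `0` only the round that pops the
      -- empty list.
      enumCost : ℕ → ℕ
      enumCost zero    = 1
      enumCost (suc k) = suc roundCost + (enumCost k + enumCost k)

      1≤enumCost : ∀ k → 1 ≤ enumCost k
      1≤enumCost zero    = ≤-refl
      1≤enumCost (suc k) = s≤s z≤n

      -- With `r = suc roundCost` the recurrence sends `e` to `r + 2 * e`, which is plain doubling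
      -- for `e + r`.
      enumCost≤ : ∀ k → enumCost k + suc roundCost ≤ 2 ^ suc k * suc roundCost
      enumCost≤ zero    = begin
        1 + suc roundCost          ≤⟨ +-monoˡ-≤ (suc roundCost) {1} {suc roundCost} (s≤s z≤n) ⟩
        suc roundCost + suc roundCost   ≡⟨ cong (suc roundCost +_) (sym (+-identityʳ _)) ⟩
        2 * suc roundCost          ∎
        where open ≤-Reasoning
      enumCost≤ (suc k) = begin
        suc r + (e + e) + suc r          ≡⟨ rearrange e (suc r) ⟩
        2 * (e + suc r)                  ≤⟨ *-monoʳ-≤ 2 (enumCost≤ k) ⟩
        2 * (2 ^ suc k * suc r)          ≡⟨ sym (*-assoc 2 (2 ^ suc k) (suc r)) ⟩
        2 ^ suc (suc k) * suc r          ∎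
        where
          open ≤-Reasoning
          r = roundCost
          e = enumCost k
          rearrange : ∀ e r → r + (e + e) + r ≡ 2 * (e + r)
          rearrange = solve-∀

      record Advanced (xs : List (Fin n)) (V : List (Fin n)) (Vs : List (List (Fin n)))
                      (o : Outs n) (s : Stack) (m : Memory n) (o′ : Outs n) : Set where
        field
          x     : Fin n
          V∖x W : List (Fin n)
          s≡    : s ≡ (x ∷ xs , W ∷ V∖x ∷ Vs)
          V↭    : V ↭ x ∷ V∖x
          W↭    : W ↭ filter (_∈? nb x) V
          ready : Ready nb m
          o≡    : o′ ≡ o ++ (x ∷ xs) ∷ []

      runs-cliqueStep : ∀ {σ xs y V Vs} → length xs + length (y ∷ V) ≤ D →
                        (∀ {u} → u ∈ y ∷ V → u ∈ F) → Ready nb (memory σ) →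
                        Runs χ (cliqueStep (xs , (y ∷ V) ∷ Vs)) σ roundCost λ r m o →
                          ∃[ s ] r ≡ inj₁ s × Advanced xs (y ∷ V) Vs (outputs σ) s m o
      runs-cliqueStep {σ} {xs} {y} {V} ≤D V⊆F r = within bound
        (runs-choose λ i → runs-output (runs-bind
          (runs-∩N (y ∷ V) (V⊆F (∈-resp-↭ (↭-sym (removeAt-↭ (y ∷ V) i)) (here refl))) r)
          λ { W (W↭ , r′ , refl) → runs-return (_ , refl , record
            { s≡ = refl ; V↭ = removeAt-↭ (y ∷ V) i ; W↭ = W↭ ; ready = r′ ; o≡ = refl }) }))
        where
          open ≤-Reasoning
          a = length xs
          v = length V
          bound : suc v + (1 + suc a + (4 + 2 * suc v + 4 * L + 0)) ≤ roundCost
          bound = begin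
            suc v + (1 + suc a + (4 + 2 * suc v + 4 * L + 0))   ≤⟨ m≤m+n _ (3 * a + v) ⟩
            _                                                   ≡⟨ rearrange a v L ⟩
            5 + 4 * (a + suc v) + 4 * L                         ≤⟨ +-monoˡ-≤ (4 * L) (+-monoʳ-≤ 5 (*-monoʳ-≤ 4 ≤D)) ⟩
            roundCost                                           ∎
            where
              rearrange : ∀ a v l →
                suc v + (1 + suc a + (4 + 2 * suc v + 4 * l + 0)) + (3 * a + v) ≡ 5 + 4 * (a + suc v) + 4 * l
              rearrange = solve-∀

      -- What the search of `V` below the prefix `xs` achieves. The clique `xs` itself has been
      -- output before that search, so `found` asks `S` to meet `V`.
      record Explored (xs V : List (Fin n)) (o o′ : Outs n) : Set where
        field
          grows : o ⊑ o′
          sound : Sound o′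
          found : ∀ S → IsClique G S → (∀ {u} → u ∈ xs → u ∈ˢ S) → (∀ {u} → u ∈ˢ S → u ∈ xs ⊎ u ∈ V) →
                  ∃[ u ] u ∈ V × u ∈ˢ S → Listed o′ S

      explored-branch : ∀ {x xs V V∖x W o o₁ o₂} → (∀ {u} → u ∈ V → u ∈ F) →
                        V ↭ x ∷ V∖x → W ↭ filter (_∈? nb x) V →
                        Explored (x ∷ xs) W (o ++ (x ∷ xs) ∷ []) o₁ → Explored xs V∖x o₁ o₂ →
                        Explored xs V o o₂
      explored-branch {x} {xs} {V} {V∖x} {W} {o} {o₁} {o₂} V⊆F V↭ W↭ with-x without-x = record
        { grows = without.grows ∘ with-x.grows ∘ ∈-++⁺ˡ
        ; sound = without.sound
        ; found = found
        }
        where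
          module with-x = Explored with-x
          module without = Explored without-x

          found : ∀ S → IsClique G S → (∀ {u} → u ∈ xs → u ∈ˢ S) → (∀ {u} → u ∈ˢ S → u ∈ xs ⊎ u ∈ V) →
                  ∃[ u ] u ∈ V × u ∈ˢ S → Listed o₂ S
          found S cl xs⊆S S⊆ (w , w∈V , w∈S) with x ∈ˢ? S
          ... | no x∉S = without.found S cl xs⊆S (λ u∈S → Sum.map id (other u∈S) (S⊆ u∈S))
                           (w , other w∈S w∈V , w∈S)
            where
              other : ∀ {u} → u ∈ˢ S → u ∈ V → u ∈ V∖x
              other u∈S u∈V = ∈-∷⁻ (∈-resp-↭ V↭ u∈V) λ { refl → x∉S u∈S }
          ... | yes x∈S = Listed-mono without.grows (found′ (any? (_∈ˢ? S) W))
            where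
              x∷xs⊆S : ∀ {u} → u ∈ x ∷ xs → u ∈ˢ S
              x∷xs⊆S (here refl) = x∈S
              x∷xs⊆S (there u∈)  = xs⊆S u∈

              S⊆′ : ∀ {u} → u ∈ˢ S → u ∈ x ∷ xs ⊎ u ∈ W
              S⊆′ {u} u∈S with u ≟ᶠ x | S⊆ u∈S
              ... | yes u≡x | _        = inj₁ (here u≡x)
              ... | no _    | inj₁ u∈xs = inj₁ (there u∈xs)
              ... | no u≢x  | inj₂ u∈V  = inj₂ (∈-resp-↭ (↭-sym W↭) (∈-filter⁺ (_∈? nb x) u∈V
                (Equivalence.from (nb-edges (V⊆F (∈-resp-↭ (↭-sym V↭) (here refl))) (V⊆F u∈V))
                  (cl x∈S u∈S (u≢x ∘ sym)))))

              found′ : Dec _ → Listed o₁ S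
              found′ (yes meets) with u , u∈W , u∈S ← find meets =
                with-x.found S cl x∷xs⊆S S⊆′ (u , u∈W , u∈S)
              -- Without members in `W` the clique is `x ∷ xs` itself, output in the current round.
              found′ (no misses) = x ∷ xs , with-x.grows (∈-++⁺ʳ o (here refl)) , x∷xs⊆S ,
                λ u∈S → [ id , (λ u∈W → contradiction (lose u∈W u∈S) misses) ]′ (S⊆′ u∈S)

      -- The stack below V is not inspected while V is searched, hence the
      -- continuation-passing form.
      runs-cliques : ∀ {Q : ⊤ → Memory n → Outs n → Set} k {xs V Vs σ c} →
                     length V ≤ k → length xs + length V ≤ D → (∀ {u} → u ∈ V → u ∈ F) →
                     CliqueList xs → (∀ {x v} → x ∈ xs → v ∈ V → E x v) →
                     Ready nb (memory σ) → Sound (outputs σ) →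
                     (∀ {σ′} → Ready nb (memory σ′) → Explored xs V (outputs σ) (outputs σ′) →
                       Runs χ (loop cliqueStep (drop 1 xs , Vs)) σ′ c Q) →
                     Runs χ (loop cliqueStep (xs , V ∷ Vs)) σ (enumCost k + c) Q
      runs-cliques k {xs} {[]} {Vs} {σ} {c} _ _ _ _ _ r so next = within (+-monoˡ-≤ c (1≤enumCost k))
        (runs-again {P = λ s m o → s ≡ (drop 1 xs , Vs) × m ≡ memory σ × o ≡ outputs σ}
          (runs-return (_ , refl , refl , refl , refl))
          λ { _ {σ′} (refl , refl , refl) → next {σ′} r record
            { grows = id ; sound = so ; found = λ { _ _ _ _ (_ , () , _) } } })
      runs-cliques (suc k) {xs} {y ∷ V} {Vs} {σ} {c} (s≤s ≤k) ≤D V⊆F cl joined r so next =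
        within (≤-reflexive (rearrange roundCost (enumCost k) c))
        (runs-again (runs-cliqueStep ≤D V⊆F r) branch)
        where
          rearrange : ∀ b e c → suc (b + (e + (e + c))) ≡ suc b + (e + e) + c
          rearrange = solve-∀

          branch : ∀ s {σ′} → Advanced xs (y ∷ V) Vs (outputs σ) s (memory σ′) (outputs σ′) →
                   Runs χ (loop cliqueStep s) σ′ (enumCost k + (enumCost k + c)) _
          branch s {σ′} record { x = x ; V∖x = V∖x ; W = W ; s≡ = refl ; V↭ = V↭ ; W↭ = W↭
                               ; ready = r′ ; o≡ = refl } =
            runs-cliques k
              (≤-trans |W|≤ |V∖x|≤)
              -- `x` moves from the list to the prefix, so the sum of their lengths does not grow.
              (≤-trans (+-monoʳ-≤ (suc (length xs)) |W|≤) (≤-trans (≤-reflexive shape) ≤D))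
              (V⊆F ∘ W⊆V) cl′ joined′ r′ (Sound-∷ʳ so cl′)
              -- Popping the exhausted `W` drops `x` again, which leaves the prefix `xs` for the
              -- branch without `x`.
              λ r₁ e₁ → runs-cliques k |V∖x|≤
                (≤-trans (+-monoʳ-≤ (length xs) (≤-trans (n≤1+n _) (≤-reflexive (sym |V|≡)))) ≤D)
                (V⊆F ∘ V∖x⊆V) cl (λ x∈ v∈ → joined x∈ (V∖x⊆V v∈)) r₁ (Explored.sound e₁)
                λ r₂ e₂ → next r₂ (explored-branch V⊆F V↭ W↭ e₁ e₂)
            where
              |V|≡ : length (y ∷ V) ≡ suc (length V∖x)
              |V|≡ = ↭-length V↭
              |V∖x|≤ : length V∖x ≤ k
              |V∖x|≤ = subst (_≤ k) (suc-injective |V|≡) ≤k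
              shape : suc (length xs) + length V∖x ≡ length xs + length (y ∷ V)
              shape = trans (sym (+-suc (length xs) _)) (cong (length xs +_) (sym |V|≡))
              V∖x⊆V : ∀ {u} → u ∈ V∖x → u ∈ y ∷ V
              V∖x⊆V u∈ = ∈-resp-↭ (↭-sym V↭) (there u∈)
              x∈V : x ∈ y ∷ V
              x∈V = ∈-resp-↭ (↭-sym V↭) (here refl)
              W⁻ : ∀ {u} → u ∈ W → u ∈ y ∷ V × u ∈ nb x
              W⁻ u∈ = ∈-filter⁻ (_∈? nb x) {xs = y ∷ V} (∈-resp-↭ W↭ u∈)
              W⊆V : ∀ {u} → u ∈ W → u ∈ y ∷ V
              W⊆V = proj₁ ∘ W⁻
              x∉nb : x ∉ nb x
              x∉nb x∈ = E-irrefl refl (Equivalence.to (nb-edges (V⊆F x∈V) (V⊆F x∈V)) x∈)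
              |W|≤ : length W ≤ length V∖x
              |W|≤ = begin
                length W                                 ≡⟨ ↭-length W↭ ⟩
                length (filter (_∈? nb x) (y ∷ V))       ≡⟨ ↭-length (filter-↭ (_∈? nb x) V↭) ⟩
                length (filter (_∈? nb x) (x ∷ V∖x))     ≡⟨ cong length (filter-reject (_∈? nb x) x∉nb) ⟩
                length (filter (_∈? nb x) V∖x)           ≤⟨ length-filter (_∈? nb x) V∖x ⟩
                length V∖x                               ∎
                where open ≤-Reasoning
              cl′ : CliqueList (x ∷ xs)
              cl′ (here refl) (here refl) u≢v = contradiction refl u≢v
              cl′ (here refl) (there v∈)  _   = E-sym (joined v∈ x∈V)
              cl′ (there u∈)  (here refl) _   = joined u∈ x∈V
              cl′ (there u∈)  (there v∈)  u≢v = cl u∈ v∈ u≢v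
              joined′ : ∀ {z v} → z ∈ x ∷ xs → v ∈ W → E z v
              joined′ (here refl) v∈ = let v∈V , v∈nb = W⁻ v∈ in
                Equivalence.to (nb-edges (V⊆F x∈V) (V⊆F v∈V)) v∈nb
              joined′ (there z∈)  v∈ = joined z∈ (W⊆V v∈)

      -- The extra `2` pays for the output of the empty clique and for the round that finds the
      -- stack empty.
      runs-allCliques : ∀ {σ} → length F ≤ D → Ready nb (memory σ) → Sound (outputs σ) →
                        Runs χ (allCliques F) σ (2 + enumCost D) λ _ m o →
                          Ready nb m × outputs σ ⊑ o × Sound o × ListsWithin o F
      runs-allCliques {σ} ≤D r so = within (≤-reflexive (cong suc (+-comm (enumCost D) 1)))
        (runs-output (runs-cliques D ≤D ≤D id (λ ()) (λ ()) r (Sound-∷ʳ so λ ())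
          λ r′ e → runs (⇓stop ⇓return) ≤-refl
            (r′ , Explored.grows e ∘ ∈-++⁺ˡ , Explored.sound e , lists e)))
        where
          lists : ∀ {o} → Explored [] F (outputs σ ++ [] ∷ []) o → ListsWithin o F
          lists e S cl S⊆F with any? (_∈ˢ? S) F
          ... | yes meets = Explored.found e S cl (λ ()) (inj₂ ∘ S⊆F) (find meets)
          -- A set inside `F` that misses `F` is empty, and the empty clique was output at the
          -- start.
          ... | no misses = [] , Explored.grows e (∈-++⁺ʳ (outputs σ) (here refl)) , (λ ()) ,
                            λ u∈S → contradiction (lose (S⊆F u∈S) u∈S) misses

  -- Adjacency lists of an induced subgraph

  module Induction (d : ℕ) (fw-unique : ∀ u → Unique (fw u)) (fw-length : ∀ u → length (fw u) ≤ d)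
                   (fw-edge : ∀ {u w} → w ∈ fw u → E u w)
                   (edge-fw : ∀ {u w} → E u w → w ∈ fw u ⊎ u ∈ fw w)
                   (F : List (Fin n)) (F-unique : Unique F) (o₀ : Outs n) where

    record Cleared (rest : List (Fin n)) (m : Memory n) (o : Outs n) : Set where
      field
        fwd≡     : ∀ u → m fwd u ≡ fw u
        cleared  : ∀ {u} → u ∈ F → u ∈ rest ⊎ (m mark u ≡ true × m nbr u ≡ [])
        unmarked : ∀ {u} → u ∉ F → m mark u ≡ false
        rest⊆F   : ∀ {u} → u ∈ rest → u ∈ F
        silent   : o ≡ o₀

    runs-clear : ∀ u us {σ} → Cleared (u ∷ us) (memory σ) (outputs σ) →
                 Runs χ (op (write mark u true) >> op (write nbr u [])) σ 2 (λ _ → Cleared us)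
    runs-clear u us {σ} I = runs-write (runs-write⁰ record
      { fwd≡     = fwd≡
      ; cleared  = cleared′
      ; unmarked = λ x∉ → trans (set-≢ m mark {u} (λ { refl → x∉ (rest⊆F (here refl)) })) (unmarked x∉)
      ; rest⊆F   = rest⊆F ∘ there
      ; silent   = silent
      })
      where
        open Cleared I
        m : Memory n
        m = memory σ
        cleared′ : ∀ {x} → x ∈ F → x ∈ us ⊎ (set m mark u true mark x ≡ true × set m nbr u [] nbr x ≡ [])
        cleared′ {x} x∈ with u ≟ᶠ x
        ... | yes refl = inj₂ (refl , refl)
        ... | no u≢x   = Sum.map (λ x∈rest → ∈-∷⁻ x∈rest (u≢x ∘ sym)) id (cleared x∈)

    -- Shared by the two nested loops, which differ in the edges still `Pending` and in `φ x`, a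
    -- bound for the links that `x` can still receive. A link moves one unit from `φ` to the length
    -- of a list, so the sum in `size` never grows; this bounds the lists by a potential instead of
    -- by freedom from repetitions.
    record Linked (Pending : Fin n → Fin n → Set) (φ : Fin n → ℕ) (m : Memory n) (o : Outs n) : Set where
      field
        fwd≡     : ∀ u → m fwd u ≡ fw u
        marks    : ∀ {u} → u ∈ F → m mark u ≡ true
        unmarked : ∀ {u} → u ∉ F → m mark u ≡ false
        sound    : ∀ {u w} → u ∈ F → w ∈ m nbr u → E u w
        complete : ∀ {u w} → u ∈ F → w ∈ F → w ∈ fw u → Pending u w ⊎ (w ∈ m nbr u × u ∈ m nbr w)
        size     : ∀ {x} → x ∈ F → length (m nbr x) + φ x ≤ d + length F
        silent   : o ≡ o₀

    Outer : List (Fin n) → Memory n → Outs n → Set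
    Outer us m o = (∀ {u} → u ∈ us → u ∈ F) × Linked (λ u w → u ∈ us) (links fw us) m o

    Inner : Fin n → List (Fin n) → List (Fin n) → Memory n → Outs n → Set
    Inner u us ws m o = (∀ {w} → w ∈ ws → w ∈ fw u) ×
      Linked (λ u′ w → u′ ∈ us ⊎ (u′ ≡ u × w ∈ ws)) (λ x → listLinks u ws x + links fw us x) m o

    -- All lists are empty, so the whole of `size` is potential. `F` repeats no vertex, hence the
    -- own list of `x` counts only once.
    cleared⇒outer : ∀ {m o} → Cleared [] m o → Outer F m o
    cleared⇒outer {m} I = id , record
      { fwd≡     = fwd≡
      ; marks    = proj₁ ∘ all
      ; unmarked = unmarked
      ; sound    = λ u∈ w∈ → contradiction (subst (_ ∈_) (proj₂ (all u∈)) w∈) λ ()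
      ; complete = λ u∈ _ _ → inj₁ u∈
      ; size     = size
      ; silent   = silent
      }
      where
        open Cleared I
        all : ∀ {u} → u ∈ F → m mark u ≡ true × m nbr u ≡ []
        all u∈ with cleared u∈
        ... | inj₂ p = p
        open ≤-Reasoning
        size : ∀ {x} → x ∈ F → length (m nbr x) + links fw F x ≤ d + length F
        size {x} x∈ = begin
          length (m nbr x) + links fw F x     ≡⟨ cong (λ xs → length xs + links fw F x) (proj₂ (all x∈)) ⟩
          links fw F x                        ≤⟨ links≤ fw-unique fw-length F x ⟩
          d * sum (map (δ x) F) + length F    ≤⟨ +-monoˡ-≤ (length F) (*-monoʳ-≤ d (δ-sum≤1 x F-unique)) ⟩
          d * 1 + length F                    ≡⟨ cong (_+ length F) (*-identityʳ d) ⟩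
          d + length F                        ∎

    runs-link : ∀ {u us} → u ∈ F → ∀ w ws {σ} → Inner u us (w ∷ ws) (memory σ) (outputs σ) →
                Runs χ (op (read mark w) >>= λ b → if b then link u w else return tt) σ 5 (λ _ → Inner u us ws)
    runs-link {u} {us} u∈F w ws {σ} (ws⊆ , I) with w ∈? F
    ... | yes w∈F = runs-read≡ (marks w∈F) (runs-read (runs-write (runs-read (runs-write⁰ (ws⊆ ∘ there , record
      { fwd≡     = fwd≡
      ; marks    = marks
      ; unmarked = unmarked
      ; sound    = sound′
      ; complete = complete′
      ; size     = size′
      ; silent   = silent
      })))))
      where
        open Linked I
        m : Memory n
        m = memory σ
        f g : Fin n → List (Fin n)
        f = push (m nbr) u w
        g = push f w u
        uw : E u w
        uw = fw-edge (ws⊆ (here refl))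
        old : ∀ {x z} → z ∈ m nbr x → z ∈ g x
        old z∈ = push-old f w u (push-old (m nbr) u w z∈)
        sound′ : ∀ {x z} → x ∈ F → z ∈ g x → E x z
        sound′ {x} x∈ z∈ with push⁻ f w u {x} z∈
        ... | inj₂ (refl , refl) = E-sym uw
        ... | inj₁ z∈f with push⁻ (m nbr) u w {x} z∈f
        ...   | inj₂ (refl , refl) = uw
        ...   | inj₁ z∈m = sound x∈ z∈m
        complete′ : ∀ {x z} → x ∈ F → z ∈ F → z ∈ fw x →
                    (x ∈ us ⊎ (x ≡ u × z ∈ ws)) ⊎ (z ∈ g x × x ∈ g z)
        complete′ x∈ z∈ xz with complete x∈ z∈ xz
        ... | inj₁ (inj₁ x∈us)                = inj₁ (inj₁ x∈us)
        ... | inj₁ (inj₂ (refl , here refl))  = inj₂ (push-old f w u (push-new (m nbr) u w) , push-new f w u)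
        ... | inj₁ (inj₂ (refl , there z∈ws)) = inj₁ (inj₂ (refl , z∈ws))
        ... | inj₂ (z∈m , x∈m)                = inj₂ (old z∈m , old x∈m)
        open ≤-Reasoning
        size′ : ∀ {x} → x ∈ F → length (g x) + (listLinks u ws x + links fw us x) ≤ d + length F
        size′ {x} x∈ = begin
          length (g x) + (listLinks u ws x + links fw us x)
            ≡⟨ cong (_+ _) (trans (length-push f w u x) (cong (δ x w +_) (length-push (m nbr) u w x))) ⟩
          δ x w + (δ x u + length (m nbr x)) + (listLinks u ws x + links fw us x)
            ≡⟨ rearrange (δ x u) (δ x w) (length (m nbr x)) (listLinks u ws x) (links fw us x) ⟩
          length (m nbr x) + (listLinks u (w ∷ ws) x + links fw us x)
            ≤⟨ size x∈ ⟩
          d + length F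
            ∎
          where
            rearrange : ∀ a b l s t → b + (a + l) + (s + t) ≡ l + (a + b + s + t)
            rearrange = solve-∀
    -- An unmarked `w` lies outside `F`, so the pair concerns no edge of the subgraph; it leaves
    -- `Pending` and the potential can only decrease.
    ... | no w∉F = within (s≤s z≤n) (runs-read≡ (unmarked w∉F) (runs-return (ws⊆ ∘ there , record
      { fwd≡     = fwd≡
      ; marks    = marks
      ; unmarked = unmarked
      ; sound    = sound
      ; complete = complete′
      ; size     = λ {x} x∈ → ≤-trans
          (+-monoʳ-≤ (length (memory σ nbr x)) (+-monoˡ-≤ (links fw us x)
            (m≤n+m (listLinks u ws x) (δ x u + δ x w))))
          (size x∈)
      ; silent   = silent
      })))
      where
        open Linked I
        complete′ : ∀ {x z} → x ∈ F → z ∈ F → z ∈ fw x →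
                    (x ∈ us ⊎ (x ≡ u × z ∈ ws)) ⊎ (z ∈ memory σ nbr x × x ∈ memory σ nbr z)
        complete′ x∈ z∈ xz with complete x∈ z∈ xz
        ... | inj₁ (inj₁ x∈us)                = inj₁ (inj₁ x∈us)
        ... | inj₁ (inj₂ (refl , here refl))  = contradiction z∈ w∉F
        ... | inj₁ (inj₂ (refl , there z∈ws)) = inj₁ (inj₂ (refl , z∈ws))
        ... | inj₂ both                       = inj₂ both

    outer⇒inner : ∀ {u us m o} → Outer (u ∷ us) m o → Inner u us (fw u) m o
    outer⇒inner {u} {us} {m} (_ , I) = id , record
      { Linked I
      ; complete = complete′
      ; size     = size
      }
      where
        open Linked I
        complete′ : ∀ {x z} → x ∈ F → z ∈ F → z ∈ fw x →
                    (x ∈ us ⊎ (x ≡ u × z ∈ fw u)) ⊎ (z ∈ m nbr x × x ∈ m nbr z)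
        complete′ x∈ z∈ xz with complete x∈ z∈ xz
        ... | inj₁ (here refl)  = inj₁ (inj₂ (refl , xz))
        ... | inj₁ (there x∈us) = inj₁ (inj₁ x∈us)
        ... | inj₂ both         = inj₂ both

    inner⇒outer : ∀ {u us m o} → (∀ {x} → x ∈ us → x ∈ F) → Inner u us [] m o → Outer us m o
    inner⇒outer us⊆F (_ , I) = us⊆F , record
      { Linked I
      ; complete = λ x∈ z∈ xz → Sum.map [ id , (λ ()) ]′ id (Linked.complete I x∈ z∈ xz)
      }

    -- Per vertex: 3 for clearing, `3 + 6 * d` for linking and 2 for unmarking. The leading 3 counts
    -- the closing rounds.
    inducedCost : ℕ
    inducedCost = 3 + length F * (8 + 6 * d)

    record Induced (m : Memory n) (o : Outs n) : Set where
      field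
        ready  : Ready (m nbr) m
        edges  : ∀ {x u} → x ∈ F → u ∈ F → u ∈ m nbr x ⇔ E x u
        size   : ∀ {x} → x ∈ F → length (m nbr x) ≤ d + length F
        silent : o ≡ o₀

    outer⇒induced : ∀ {m o} → Outer [] m o → Induced (marked m false F) o
    outer⇒induced {m} (_ , I) = record
      { ready  = record
        { clear = clear
        ; nbr≡  = λ _ → refl
        ; fwd≡  = λ u → trans (marked-fwd m false F u) (fwd≡ u)
        }
      ; edges  = λ {x} {u} x∈ u∈ → subst (λ xs → u ∈ xs ⇔ E x u) (sym (marked-nbr m false F x))
                   (mk⇔ (sound x∈) (linked x∈ u∈))
      ; size   = λ {x} x∈ → subst (λ xs → length xs ≤ d + length F) (sym (marked-nbr m false F x))
                   (≤-trans (m≤m+n _ _) (size x∈))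
      ; silent = silent
      }
      where
        open Linked I
        clear : ∀ u → marked m false F mark u ≡ false
        clear u with u ∈? F
        ... | yes u∈ = marked-∈ m false F u∈
        ... | no  u∉ = trans (marked-∉ m false F u∉) (unmarked u∉)
        linked : ∀ {x u} → x ∈ F → u ∈ F → E x u → u ∈ m nbr x
        -- The edge is stored in `fw` at only one of its ends, but `complete` enters it in `nbr` at
        -- both.
        linked x∈ u∈ xu with edge-fw xu
        linked x∈ u∈ xu | inj₁ x→u with complete x∈ u∈ x→u
        ... | inj₂ (u∈nbr , _) = u∈nbr
        linked x∈ u∈ xu | inj₂ u→x with complete u∈ x∈ u→x
        ... | inj₂ (_ , u∈nbr) = u∈nbr

    runs-induce : ∀ {σ} → (∀ u → memory σ mark u ≡ false) → (∀ u → memory σ fwd u ≡ fw u) → outputs σ ≡ o₀ →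
                  Runs χ (induce F) σ inducedCost (λ _ → Induced)
    runs-induce {σ} clear fwd≡ silent = within (≤-reflexive (rearrange (length F) d))
      (runs-bind (runs-forEach Cleared 2 runs-clear F record
        { fwd≡     = fwd≡
        ; cleared  = inj₁
        ; unmarked = λ {u} _ → clear u
        ; rest⊆F   = id
        ; silent   = silent
        })
      λ _ I → runs-bind (runs-forEach Outer (2 + d * 6) visit F (cleared⇒outer I))
      λ _ J → weaken ≤-refl (λ { (refl , refl) → outer⇒induced J }) (runs-mark false F))
      where
        rearrange : ∀ f d → suc (f * 3) + (suc (f * suc (2 + d * 6)) + suc (f * 2)) ≡ 3 + f * (8 + 6 * d)
        rearrange = solve-∀
        visit : ∀ u us {σ} → Outer (u ∷ us) (memory σ) (outputs σ) → Runs χ _ σ (2 + d * 6) (λ _ → Outer us)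
        visit u us I@(us⊆F , L) = runs-read≡ (Linked.fwd≡ L u) (weaken
          (s≤s (*-monoˡ-≤ 6 (fw-length u)))
          (inner⇒outer (us⊆F ∘ there))
          (runs-forEach (Inner u us) 5 (runs-link (us⊆F (here refl))) (fw u) (outer⇒inner I)))

-- From a degenerate ordering to all cliques

module Ordered {n : ℕ} (G : Graph n) (d : ℕ) {fw : Fin n → List (Fin n)} {vs : List (Fin n)}
               (vs↭ : vs ↭ allFin n) (fs : Orderings.Forward G d fw vs) where
  open Graph G
  open Orderings G d

  ∈vs : ∀ u → u ∈ vs
  ∈vs u = ∈-resp-↭ (↭-sym vs↭) (∈-allFin u)

  vs-unique : Unique vs
  vs-unique = unique-resp-↭ (↭-sym vs↭) (allFin⁺ n)

  Forward-lookup : ∀ {us u} → Forward fw us → Unique us → u ∈ us → ∃[ ts ] ForwardAt fw u ts × Unique ts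
  Forward-lookup (f , _)  un (here refl) = _ , f , tail un
  Forward-lookup (_ , fs) un (there u∈)  = Forward-lookup fs (tail un) u∈

  private
    at : ∀ u → ∃[ ts ] ForwardAt fw u ts × Unique ts
    at u = Forward-lookup fs vs-unique (∈vs u)

  fw-unique : ∀ u → Unique (fw u)
  fw-unique u = let _ , (f , _) , un = at u in unique-resp-↭ (↭-sym f) (filter⁺ (E? u) un)

  fw-length : ∀ u → length (fw u) ≤ d
  fw-length u = let _ , (f , ≤d) , _ = at u in subst (_≤ d) (sym (↭-length f)) ≤d

  fw-edge : ∀ {u w} → w ∈ fw u → E u w
  fw-edge {u} w∈ = let ts , (f , _) , _ = at u in proj₂ (∈-filter⁻ (E? u) {xs = ts} (∈-resp-↭ f w∈))

  self-∉fw : ∀ u → u ∉ fw u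
  self-∉fw u u∈ = E-irrefl refl (fw-edge u∈)

  private
    forward-edge : ∀ {us u w} → ForwardAt fw u us → w ∈ us → E u w → w ∈ fw u
    forward-edge {u = u} (f , _) w∈ uw = ∈-resp-↭ (↭-sym f) (∈-filter⁺ (E? u) w∈ uw)

  -- Whichever end comes first in the ordering has the other among its later neighbours.
  edge-fw : ∀ {u w} → E u w → w ∈ fw u ⊎ u ∈ fw w
  edge-fw {u} {w} uw = go fs (∈vs u) (∈vs w)
    where
      go : ∀ {us} → Forward fw us → u ∈ us → w ∈ us → w ∈ fw u ⊎ u ∈ fw w
      go _        (here refl) (here refl) = contradiction uw (E-irrefl refl)
      go (f , _)  (here refl) (there w∈)  = inj₁ (forward-edge f w∈ uw)
      go (f , _)  (there u∈)  (here refl) = inj₂ (forward-edge f u∈ (E-sym uw))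
      go (_ , fs) (there u∈)  (there w∈)  = go fs u∈ w∈

  -- The ordering is scanned for the first member of `S`; the given member `u` ensures that the scan
  -- stops.
  clique⊆forward : ∀ S → IsClique G S → ∀ {u} → u ∈ˢ S → ∃[ v ] (∀ {w} → w ∈ˢ S → w ∈ v ∷ fw v)
  clique⊆forward S cl {u} u∈S = go fs (∈vs u) (λ {w} _ → ∈vs w)
    where
      go : ∀ {us} → Forward fw us → u ∈ us → (∀ {w} → w ∈ˢ S → w ∈ us) →
           ∃[ v ] (∀ {w} → w ∈ˢ S → w ∈ v ∷ fw v)
      go {v ∷ us} (f , fs) u∈ S⊆ with v ∈ˢ? S
      ... | yes v∈S = v , λ w∈S → first w∈S (S⊆ w∈S)
        where
          first : ∀ {w} → w ∈ˢ S → w ∈ v ∷ us → w ∈ v ∷ fw v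
          first {w} w∈S w∈ with w ≟ᶠ v
          ... | yes w≡v = here w≡v
          ... | no w≢v  = there (forward-edge f (∈-∷⁻ w∈ w≢v) (cl v∈S w∈S (w≢v ∘ sym)))
      ... | no v∉S = go fs (others u∈S u∈) λ w∈S → others w∈S (S⊆ w∈S)
        where
          others : ∀ {w} → w ∈ˢ S → w ∈ v ∷ us → w ∈ us
          others w∈S w∈ = ∈-∷⁻ w∈ λ { refl → v∉S w∈S }

-- One read, `inducedCost` for at most `d + 1` vertices, and `allCliques`. There `14 + 12 * d` is
-- `suc roundCost` for `D = d + 1` and `L = 2 * d + 1`.
vertexCost : ℕ → ℕ
vertexCost d = 1 + ((3 + suc d * (8 + 6 * d)) + (2 + 2 ^ suc (suc d) * (14 + 12 * d)))

module Listing {n : ℕ} (G : Graph n) (χ : Chooser n) (d : ℕ)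
               {fw : Fin n → List (Fin n)} {vs : List (Fin n)}
               (vs↭ : vs ↭ allFin n) (fs : Orderings.Forward G d fw vs) where
  open Graph G
  open Ordered G d vs↭ fs
  open Cliques G χ fw

  record Listing (rest : List (Fin n)) (m : Memory n) (o : Outs n) : Set where
    field
      clear : ∀ u → m mark u ≡ false
      fwd≡  : ∀ u → m fwd u ≡ fw u
      sound : Sound o
      lists : ∀ u → u ∈ rest ⊎ ListsWithin o (u ∷ fw u)

  runs-visit : ∀ v rest {σ} → Listing (v ∷ rest) (memory σ) (outputs σ) →
               Runs χ (op (read fwd v) >>= λ ws → induce (v ∷ ws) >> allCliques (v ∷ ws)) σ (vertexCost d)
                    (λ _ → Listing rest)
  runs-visit v rest {σ} I = runs-read≡ (fwd≡ v) (runs-bind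
      (within (+-monoʳ-≤ 3 (*-monoˡ-≤ (8 + 6 * d) |F|≤)) (runs-induce clear fwd≡ refl))
      λ _ {σ′} J → let open Induced J
                       -- This `L` is the bound `d + length F` for the lists in `nbr`, with
                       -- `length F ≤ suc d`.
                       open Enumeration F (memory σ′ nbr) edges (d + suc d)
                              (λ x∈ → ≤-trans (size x∈) (+-monoʳ-≤ d |F|≤)) in
        weaken (+-monoʳ-≤ 2 (≤-trans (≤-trans (m≤m+n _ _) (enumCost≤ (suc d) (suc d)))
                              (≤-reflexive (cong (2 ^ suc (suc d) *_) (rearrange d)))))
               (λ { (r , grows , so , new) → record
                 { clear = Ready.clear r
                 ; fwd≡  = Ready.fwd≡ r
                 ; sound = so
                 ; lists = extend (subst (_⊑ _) silent grows) new
                 } })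
               (runs-allCliques (suc d) |F|≤ ready (subst Sound (sym silent) sound)))
    where
      open Listing I
      F : List (Fin n)
      F = v ∷ fw v
      open Induction d fw-unique fw-length fw-edge edge-fw
                     F (unique-∷ (self-∉fw v) (fw-unique v)) (outputs σ)
      |F|≤ : length F ≤ suc d
      |F|≤ = s≤s (fw-length v)
      rearrange : ∀ d → 1 + (5 + 4 * (1 + d) + 4 * (d + (1 + d))) ≡ 14 + 12 * d
      rearrange = solve-∀
      extend : ∀ {o} → outputs σ ⊑ o → ListsWithin o F → ∀ u → u ∈ rest ⊎ ListsWithin o (u ∷ fw u)
      extend grows new u with lists u
      ... | inj₁ (here refl) = inj₂ new
      ... | inj₁ (there u∈)  = inj₁ u∈
      ... | inj₂ old         = inj₂ λ S cl S⊆ → Listed-mono grows (old S cl S⊆)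

  runs-listing : ∀ {σ} → (∀ v → memory σ fwd v ≡ fw v) → outputs σ ≡ [] →
                 Runs χ (forEach vs (λ v → op (write mark v false)) >> forEach vs (λ v →
                           op (read fwd v) >>= λ ws → induce (v ∷ ws) >> allCliques (v ∷ ws)))
                      σ (suc (n * 2) + suc (n * suc (vertexCost d)))
                      (λ _ → Listing [])
  runs-listing {σ} fwd≡ silent = within
    (≤-reflexive (cong (λ l → suc (l * 2) + suc (l * suc (vertexCost d)))
                       (trans (↭-length vs↭) (length-allFin n))))
    (runs-bind (runs-mark false vs) λ { _ (refl , refl) →
      runs-forEach Listing (vertexCost d) runs-visit vs record
        { clear = λ u → marked-∈ (memory σ) false vs (∈vs u)
        ; fwd≡  = λ u → trans (marked-fwd (memory σ) false vs u) (fwd≡ u)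
        ; sound = λ ys∈ → contradiction (subst (_ ∈_) silent ys∈) λ ()
        ; lists = λ u → inj₁ (∈vs u)
        } })

  listing⇒cliques : ∀ {σ} → Fin n → Listing [] (memory σ) (outputs σ) → ∀ S → IsClique G S ⇔ Outputs σ S
  listing⇒cliques {σ} v₀ I S = mk⇔ to from
    where
      open Listing I
      within-any : ∀ u → ListsWithin (outputs σ) (u ∷ fw u)
      within-any u with lists u
      ... | inj₂ l = l

      listed : IsClique G S → Listed (outputs σ) S
      listed cl with any? (_∈ˢ? S) (allFin n)
      ... | yes meets = let _ , _ , u∈S = find meets
                            v , S⊆ = clique⊆forward S cl u∈S
                        in within-any v S cl S⊆
      -- The empty clique has no first vertex; the run for any vertex `v₀` lists it.
      ... | no misses = within-any v₀ S cl λ {u} u∈S → contradiction (lose (∈-allFin u) u∈S) misses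

      to : IsClique G S → Outputs σ S
      to cl with ys , ys∈ , ys⊆S , S⊆ys ← listed cl =
        subst (_∈ _) (⊆-antisym (ys⊆S ∘ ⋃⁻ ys) (⋃⁺ ∘ S⊆ys)) (∈-map⁺ _ ys∈)

      from : Outputs σ S → IsClique G S
      from S∈ u∈ v∈ u≢v with ys , ys∈ , refl ← ∈-map⁻ _ S∈ = sound ys∈ (⋃⁻ ys u∈) (⋃⁻ ys v∈) u≢v

-- Constants of the final time bound

1+d≤2ᵈ : ∀ d → suc d ≤ 2 ^ d
1+d≤2ᵈ zero    = ≤-refl
1+d≤2ᵈ (suc d) = begin
  1 + suc d              ≤⟨ +-mono-≤ (1≤2^ d) (1+d≤2ᵈ d) ⟩
  2 ^ d + 2 ^ d          ≡⟨ cong (2 ^ d +_) (sym (+-identityʳ (2 ^ d))) ⟩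
  2 * 2 ^ d              ∎
  where open ≤-Reasoning

-- `132 = 14 + 8 + 6 + 56 + 48`. The quadratic term, which comes from building the subgraph, is
-- absorbed by `1+d≤2ᵈ`; all other terms need only `1 ≤ d` and `1 ≤ 2 ^ d`.
vertexCost≤ : ∀ d → 1 ≤ d → vertexCost d ≤ 132 * (d * 2 ^ d)
vertexCost≤ d 1≤d = begin
  1 + ((3 + suc d * (8 + 6 * d)) + (2 + 2 ^ suc (suc d) * (14 + 12 * d)))
    ≡⟨ expand d (2 ^ d) ⟩
  14 * 1 + 8 * d + 6 * (d * suc d) + (56 * (1 * 2 ^ d) + 48 * (d * 2 ^ d))
    ≤⟨ +-mono-≤
         (+-mono-≤ (+-mono-≤ (*-monoʳ-≤ 14 (1≤m*n 1≤d (1≤2^ d)))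
                             (*-monoʳ-≤ 8 (subst (_≤ d * 2 ^ d) (*-identityʳ d) (*-monoʳ-≤ d (1≤2^ d)))))
                   (*-monoʳ-≤ 6 (*-monoʳ-≤ d (1+d≤2ᵈ d))))
         (+-monoˡ-≤ (48 * (d * 2 ^ d)) (*-monoʳ-≤ 56 (*-monoˡ-≤ (2 ^ d) 1≤d))) ⟩
  14 * (d * 2 ^ d) + 8 * (d * 2 ^ d) + 6 * (d * 2 ^ d) + (56 * (d * 2 ^ d) + 48 * (d * 2 ^ d))
    ≡⟨ collect (d * 2 ^ d) ⟩
  132 * (d * 2 ^ d)
    ∎
  where
    open ≤-Reasoning
    expand : ∀ d p → 1 + ((3 + (1 + d) * (8 + 6 * d)) + (2 + 2 * (2 * p) * (14 + 12 * d)))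
                   ≡ 14 * 1 + 8 * d + 6 * (d * (1 + d)) + (56 * (1 * p) + 48 * (d * p))
    expand = solve-∀
    collect : ∀ q → 14 * q + 8 * q + 6 * q + (56 * q + 48 * q) ≡ 132 * q
    collect = solve-∀

-- `137 = 132 + 5`: the pass that clears the marks accounts for 3, the closing round of the main
-- loop for 1, and its round per vertex for 1.
degenerateCliques-correct :
  (ordering : OrderingRoutine) (c₀ : ℕ) → ComputesOrdering ordering c₀ →
  ∀ n d (G : Graph n) (χ : Chooser n) (σ : State n) →
  1 ≤ n → Degenerate G d → Input G σ →
  ∃[ σ′ ]
    (χ ⊢⟨ degenerateCliques ordering d , σ ⟩⇓⟨ tt , σ′ ⟩)
    × (∀ S → IsClique G S ⇔ Outputs σ′ S)
    × TimeBound (c₀ + 137) d n (time σ′)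
degenerateCliques-correct ordering c₀ computes n@(suc _) d G χ σ 1≤n dg input
  with vs , σ₁ , run₁ , (vs↭ , ≤d) , fwd↭ , silent , time₁ ← computes n d G χ σ 1≤n dg input =
  final , ⇓bind run₁ run , listing⇒cliques {final} zero post , bound
  where
    open Orderings G d
    open Listing G χ d {memory σ₁ fwd} vs↭ (N⁺⇒Forward vs λ i → fwd↭ i , ≤d i)
    open Runs (runs-listing {σ₁} (λ _ → refl) silent)
    open ≤-Reasoning
    bound : TimeBound (c₀ + 137) d n (time final)
    bound 1≤d = begin
      time final
        ≤⟨ cost ⟩
      suc (n * 2) + suc (n * suc (vertexCost d)) + time σ₁
        ≤⟨ +-mono-≤ (+-mono-≤ (+-mono-≤ (1≤m*n 1≤q 1≤n) (*-monoˡ-≤ 2 n≤qn))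
                              (+-mono-≤ (1≤m*n 1≤q 1≤n) (*-monoʳ-≤ n (+-mono-≤ 1≤q (vertexCost≤ d 1≤d)))))
                    (time₁ 1≤d) ⟩
      q * n + q * n * 2 + (q * n + n * (q + 132 * q)) + c₀ * (q * n)
        ≡⟨ rearrange q n c₀ ⟩
      (c₀ + 137) * (q * n)
        ∎
      where
        q = d * 2 ^ d
        1≤q : 1 ≤ q
        1≤q = 1≤m*n 1≤d (1≤2^ d)
        n≤qn : n ≤ q * n
        n≤qn = subst (_≤ q * n) (*-identityˡ n) (*-monoˡ-≤ n 1≤q)
        rearrange : ∀ q n c →
          q * n + q * n * 2 + (q * n + n * (q + 132 * q)) + c * (q * n) ≡ (c + 137) * (q * n)
        rearrange = solve-∀

theorem4 : (∃[ c ] ComputesOrdering peel c)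
    × ((ordering : OrderingRoutine) (c₀ : ℕ) → ComputesOrdering ordering c₀ →
    ∃[ c ] ∀ n d (G : Graph n) (χ : Chooser n) (σ : State n) →
    1 ≤ n → Degenerate G d → Input G σ →
    ∃[ σ′ ]
    (χ ⊢⟨ degenerateCliques ordering d , σ ⟩⇓⟨ tt , σ′ ⟩)
    × (∀ S → IsClique G S ⇔ Outputs σ′ S)
    × TimeBound c d n (time σ′))
theorem4 = (27 , peel-computesOrdering)
         , λ ordering c₀ computes → c₀ + 137 , degenerateCliques-correct ordering c₀ computes
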